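{- For every constant $c\ge 1$ there is a constant $C>0$ (depending only on $c$) such that every graph $G=(V,E)$ with $n=|V|\ge 2$ vertices, minimum degree $\delta$ and maximum degree $\Delta\le c\,\delta$ satisfies $$\mathcal{R}(G)\;\ge\; C\cdot\frac{\sqrt{n}}{\sqrt{\delta}}\cdot\frac{1}{\log n}.$$
   Context: Graphs are finite, undirected, simple and connected. A random walk on $G$ moves at each step from its current vertex to a neighbor chosen uniformly at random. The cover time $\mathsf{COV}(s)$ is the expected number of steps for the walk started at $s$ to visit all vertices, and $\mathsf{COV}(G)=\max_{s\in V}\mathsf{COV}(s)$. Randomized broadcast algorithm $\mathsf{RBA}$ (push algorithm): at time $0$ only a vertex $s$ knows a rumor; at each time step $t=1,2,\dots$ every vertex that knows the rumor chooses, independently, a neighbor uniformly at random and informs it. $I_t$ is the set of informed vertices at time $t$ ($I_0=\{s\}$). The expected broadcast time is $\mathbf{E}[\mathsf{RBA}(G)]:=\max_{s\in V}\mathbf{E}[\min\{t: I_t=V\}\text{ with } I_0=\{s\}]$. Finally $\mathcal{R}(G):=\mathsf{COV}(G)/\mathbf{E}[\mathsf{RBA}(G)]$. -}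

module Defs where

open import Data.Bool.Base using (if_then_else_)
open import Data.Fin.Base as Fin using (Fin; zero; suc)
import Data.Fin.Properties as Fin
open import Data.Fin.Subset using (Subset; _∈_; _∪_; ⋃; ⁅_⁆)
open import Data.Fin.Subset.Properties using (_∈?_)
open import Data.Integer.Base using (+_)
open import Data.List.Base as List using (List; []; _∷_; length; allFin; filter; foldr; concatMap)
open import Data.Nat.Base using (ℕ; zero; suc; _⊔_; _⊓_)
open import Data.Product.Base using (∃; ∃-syntax; _×_; _,_; map₁; map₂)
open import Data.Rational.Base as ℚ using (ℚ; 0ℚ; 1ℚ)
import Data.Rational.Properties as ℚ
open import Data.Sum.Base using (_⊎_; inj₁; inj₂)
open import Data.Vec.Base as Vec using (Vec; lookup; [_]) renaming (_∷_ to _∷ᵛ_)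
open import Function.Base using (_∘_)
open import Level using (0ℓ)
open import Relation.Binary.Construct.Closure.ReflexiveTransitive using (Star)
open import Relation.Binary.Core using (Rel)
import Relation.Binary.Definitions as B
open import Relation.Binary.PropositionalEquality.Core using (_≡_)
open import Relation.Nullary.Decidable.Core using (does; _×-dec_)
open import Relation.Nullary.Negation.Core using (¬_)
open import Relation.Unary using (Pred; Decidable)

------------------------------------------------------------------------
-- Extended non-negative reals

-- A number x ∈ [0,∞] is given by its open lower Dedekind cut { q ∈ ℚ | q < x };
-- ∞ is the cut ℚ.
record [0,∞] : Set₁ where
  field
    Below      : Pred ℚ 0ℓ
    neg-below  : ∀ {q} → q ℚ.< 0ℚ → Below q
    down-close : ∀ {p q} → p ℚ.≤ q → Below q → Below p
    rounded    : ∀ {q} → Below q → ∃[ r ] q ℚ.< r × Below r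

open [0,∞] public using (Below)

-- sup S is the supremum of S ∪ {0}.
sup : Pred ℚ 0ℓ → [0,∞]
sup S = record
  { Below      = λ q → q ℚ.< 0ℚ ⊎ ∃[ s ] S s × q ℚ.< s
  ; neg-below  = inj₁
  ; down-close = λ where
      p≤q (inj₁ q<0)           → inj₁ (ℚ.≤-<-trans p≤q q<0)
      p≤q (inj₂ (s , Ss , q<s)) → inj₂ (s , Ss , ℚ.≤-<-trans p≤q q<s)
  ; rounded    = λ where
      (inj₁ q<0) →
        let r , q<r , r<0 = ℚ.<-dense q<0 in r , q<r , inj₁ r<0
      (inj₂ (s , Ss , q<s)) →
        let r , q<r , r<s = ℚ.<-dense q<s in r , q<r , inj₂ (s , Ss , r<s)
  }

⨆ : {I : Set} → (I → [0,∞]) → [0,∞]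
⨆ x = sup λ q → ∃[ i ] Below (x i) q

fromℚ : ℚ → [0,∞]
fromℚ q = sup (_≡ q)

fromℕ : ℕ → [0,∞]
fromℕ k = fromℚ (+ k ℚ./ 1)

infix  4 _≤∞_
infixl 7 _·_ _÷_
infix  8 √_

_≤∞_ : Rel [0,∞] 0ℓ
x ≤∞ y = ∀ q → Below x q → Below y q

Positive : [0,∞] → Set
Positive x = Below x 0ℚ

Finite : [0,∞] → Set
Finite x = ∃[ r ] x ≤∞ fromℚ r

_·_ : [0,∞] → [0,∞] → [0,∞]
x · y = sup λ t → ∃[ a ] ∃[ b ]
  0ℚ ℚ.≤ a × Below x a × 0ℚ ℚ.≤ b × Below y b × t ≡ a ℚ.* b

-- The supremum of the fractions t = a / r with a < x and y ≤ r, r > 0.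
-- This is the usual quotient for 0 < y < ∞, and x ÷ ∞ = 0.
_÷_ : [0,∞] → [0,∞] → [0,∞]
x ÷ y = sup λ t → ∃[ a ] ∃[ r ]
  Below x a × 0ℚ ℚ.< r × y ≤∞ fromℚ r × t ℚ.* r ≡ a

√_ : [0,∞] → [0,∞]
√ x = sup λ a → 0ℚ ℚ.≤ a × Below x (a ℚ.* a)

-- a ^ j / j !
expTerm : ℚ → ℕ → ℚ
expTerm a zero    = 1ℚ
expTerm a (suc j) = expTerm a j ℚ.* a ℚ.* (+ 1 ℚ./ suc j)

expSum : ℚ → ℕ → ℚ
expSum a zero    = 0ℚ
expSum a (suc k) = expSum a k ℚ.+ expTerm a k

-- Meaningful for a ≥ 0, where the exponential series is the supremum of its
-- partial sums.
exp : ℚ → [0,∞]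
exp a = ⨆ (fromℚ ∘ expSum a)

-- The natural logarithm for x ≥ 1 (for x < 1 the value is 0).
log : [0,∞] → [0,∞]
log x = sup λ a → 0ℚ ℚ.≤ a × exp a ≤∞ x

------------------------------------------------------------------------
-- Finite probability distributions and Markov chains

-- Outcomes with their probabilities; an outcome may be listed repeatedly, in
-- which case its probabilities add up.
Dist : Set → Set
Dist A = List (ℚ × A)

private
  variable
    A S : Set

return : A → Dist A
return a = (1ℚ , a) ∷ []

infixl 1 _>>=_

_>>=_ : {B : Set} → Dist A → (A → Dist B) → Dist B
d >>= f = concatMap (λ (p , a) → List.map (map₁ (p ℚ.*_)) (f a)) d

mapᴰ : {B : Set} → (A → B) → Dist A → Dist B
mapᴰ f = List.map (map₂ f)

-- The uniform distribution on the entries of a non-empty list; the empty list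
-- gives the zero measure.
uniform : List A → Dist A
uniform []         = []
uniform (x ∷ xs) = List.map (+ 1 ℚ./ suc (length xs) ,_) (x ∷ xs)

independently : List (Dist A) → Dist (List A)
independently []       = return []
independently (d ∷ ds) = d >>= λ a → mapᴰ (a ∷_) (independently ds)

𝔼 : Dist A → (A → ℕ) → ℚ
𝔼 d f = foldr (λ (p , a) e → p ℚ.* (+ f a ℚ./ 1) ℚ.+ e) 0ℚ d

-- Law of the states (X₀ , … , X_N) of the Markov chain started at X₀ = s.
trajectory : (S → Dist S) → (N : ℕ) → S → Dist (Vec S (suc N))
trajectory step zero    s = return [ s ]
trajectory step (suc N) s = step s >>= λ s′ → mapᴰ (s ∷ᵛ_) (trajectory step N s′)

-- The least i with P i, or N if there is none.
least : ∀ {N} {P : Pred (Fin N) 0ℓ} → Decidable P → ℕ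
least {zero}  P? = zero
least {suc N} P? = if does (P? zero) then zero else suc (least (P? ∘ suc))

-- Let T be the first time t at which Stop holds, where Stop ω t depends only on
-- the states up to time t.  On a trajectory ω of times 0 … N, `least (stop? ω)`
-- is min(T , N + 1), so the following is E[T] = sup_N E[min(T , N + 1)], the
-- expectation of a random variable T with values in ℕ ∪ {∞}.
expectedTime : (S → Dist S) → {Stop : ∀ {N} → Vec S N → Pred (Fin N) 0ℓ} →
               (∀ {N} (ω : Vec S N) → Decidable (Stop ω)) → S → [0,∞]
expectedTime step stop? s =
  ⨆ λ N → fromℚ (𝔼 (trajectory step N s) (λ ω → least (stop? ω)))

------------------------------------------------------------------------
-- Graphs

record Graph (n : ℕ) : Set₁ where
  infix 4 _~_ _~?_
  field
    _~_       : Rel (Fin n) 0ℓ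
    _~?_      : B.Decidable _~_
    ~-sym     : ∀ {u v} → u ~ v → v ~ u
    ~-irrefl  : ∀ {v} → ¬ v ~ v
    connected : ∀ u v → Star _~_ u v

module _ {n : ℕ} (G : Graph n) where
  open Graph G

  neighbours : Fin n → List (Fin n)
  neighbours v = filter (v ~?_) (allFin n)

  degree : Fin n → ℕ
  degree v = length (neighbours v)

  -- Every degree is at most n, so the initial value n does not affect the
  -- minimum when n ≥ 1.
  minDegree : ℕ
  minDegree = foldr _⊓_ n (List.map degree (allFin n))

  maxDegree : ℕ
  maxDegree = foldr _⊔_ 0 (List.map degree (allFin n))

  walkStep : Fin n → Dist (Fin n)
  walkStep v = uniform (neighbours v)

  Covered : ∀ {N} → Vec (Fin n) N → Pred (Fin N) 0ℓ
  Covered ω t = ∀ v → ∃[ i ] i Fin.≤ t × lookup ω i ≡ v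

  covered? : ∀ {N} (ω : Vec (Fin n) N) → Decidable (Covered ω)
  covered? ω t =
    Fin.all? λ v → Fin.any? λ i → (i Fin.≤? t) ×-dec (lookup ω i Fin.≟ v)

  COVfrom : Fin n → [0,∞]
  COVfrom = expectedTime walkStep covered?

  COV : [0,∞]
  COV = ⨆ COVfrom

  pushStep : Subset n → Dist (Subset n)
  pushStep I =
    mapᴰ (λ chosen → I ∪ ⋃ (List.map ⁅_⁆ chosen))
         (independently (List.map (uniform ∘ neighbours) (filter (_∈? I) (allFin n))))

  AllInformed : ∀ {N} → Vec (Subset n) N → Pred (Fin N) 0ℓ
  AllInformed ω t = ∀ v → v ∈ lookup ω t

  allInformed? : ∀ {N} (ω : Vec (Subset n) N) → Decidable (AllInformed ω)
  allInformed? ω t = Fin.all? (_∈? lookup ω t)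

  RBAfrom : Fin n → [0,∞]
  RBAfrom s = expectedTime pushStep allInformed? ⁅ s ⁆

  𝔼[RBA] : [0,∞]
  𝔼[RBA] = ⨆ RBAfrom

  𝓡 : [0,∞]
  𝓡 = COV ÷ 𝔼[RBA]

{-# OPTIONS --safe #-}
-- Let τ(v) be the time at which the push algorithm informs v, and 𝓔 the Dirichlet
-- form of the graph.  While y is uninformed and k of its neighbours are informed,
-- y is informed in the next step with probability at least k / (Δ + k); hence a
-- supermartingale argument bounds E[∑ (τ y - τ x)² over informed neighbours x] by
-- O(Δ²), and E[𝓔(τ , τ)] = O(n Δ²).  On the other hand, testing h against the
-- expected hitting times u of a vertex t, whose Laplacian is comparable to the
-- degree off t, gives
--   ∑ d(x) (h(x) - h(t)) ≤ 𝓔(u , h) ≤ l vol M + 𝓔(h , h) / 2l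
-- for every l > 0 and every h minimal at t, where M is the largest hitting time.
-- Applying this to τ at the source and to -τ at the last informed vertex yields
-- E[broadcast time] ≤ 2 l M + O(δ) / l.  Since M ≤ COV and M = Ω(n), the choice
-- l = √(δ / n) gives 𝓡 = Ω(√(n / δ)); the logarithm is only used through log n ≥ 1/2.
module Submission where

open import Defs
open import Algebra.Bundles using (CommutativeRing)
open import Data.Bool.Base using (true; false; if_then_else_)
open import Data.Fin.Base as Fin using (Fin; zero; suc)
import Data.Fin.Properties as Fin
open import Data.Fin.Subset using (Subset; _∈_; _∉_; _⊆_; _∪_; ⋃; ⁅_⁆)
open import Data.Fin.Subset.Properties using (_∈?_; p⊆p∪q; q⊆p∪q; x∈⁅x⁆)
open import Data.Integer.Base as ℤ using () renaming (+_ to pos)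
import Data.Integer.Properties as ℤ
open import Data.List.Base as List using (List; []; _∷_; _++_; length; allFin; tabulate; filter)
import Data.List.Membership.Propositional as List
open import Data.List.Membership.Propositional.Properties using (∈-filter⁺; ∈-length; ∈-allFin; ∈-map⁺)
open import Data.List.Relation.Unary.Any using (here; there)
open import Data.Nat.Base as ℕ using (ℕ; zero; suc; _≤_; _⊓_; _⊔_)
open import Data.Nat.Coprimality as Coprimality using (1-coprimeTo)
import Data.Nat.Properties as ℕ
open import Data.Product.Base using (∃-syntax; _×_; _,_; map₁; proj₁; proj₂)
open import Data.Rational.Base as ℚ using (ℚ; 0ℚ; 1ℚ; ½; mkℚ; _+_; _*_; _-_; -_)
import Data.Rational.Properties as ℚ
open import Data.Sum.Base using (inj₁; inj₂)
open import Data.Vec.Base as Vec using (Vec; lookup)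
open import Function.Base using (_∘_; id)
open import Level using (0ℓ)
open import Relation.Binary.Construct.Closure.ReflexiveTransitive using (Star; ε; _◅_)
open import Relation.Binary.PropositionalEquality
open import Relation.Nullary.Decidable using (Dec; yes; no; does; dec⇒maybe; dec-true; dec-false; _×-dec_)
open import Relation.Nullary.Negation using (¬_; contradiction)
open import Relation.Unary using (Pred; Decidable)
open import Tactic.RingSolver using (solve-∀)
open import Tactic.RingSolver.Core.AlmostCommutativeRing using (AlmostCommutativeRing; fromCommutativeRing)

open import Algebra.Properties.Semiring.Sum (CommutativeRing.semiring ℚ.+-*-commutativeRing)
  using (sum; sum-cong-≗; ∑-distrib-+; ∑-comm; *-distribˡ-sum; *-distribʳ-sum)

-- Bounding each squared delay separately, by a geometric variable of mean at most Δ, would only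
-- give energy O(n Δ³) and lose a factor √δ in the final bound. Treating all neighbours of y
-- together gains it back: k informed neighbours push towards y about k times as hard as one, so the
-- sum of their squared delays is of the same order as a single one. The inequality for test
-- functions h is deterministic. The random τ is therefore inserted run by run, and only its energy
-- is averaged. All quantities are kept rational and finite-horizon. Hitting times are truncated at
-- k, and this disturbs their Laplacian off t only by the probability of surviving k steps; a bound
-- on the truncated times uniform in k yields a horizon at which that probability is at most one
-- half. Square roots are avoided as well: AM-GM with a weight l and its inverse μ replaces
-- Cauchy-Schwarz, and l is the inverse of a rational x with x² δ ≤ 4 n.

private
  variable
    A B : Set
    n : ℕ

-- Rational arithmetic.

ringℚ : AlmostCommutativeRing 0ℓ 0ℓ
ringℚ = fromCommutativeRing ℚ.+-*-commutativeRing λ p → dec⇒maybe (0ℚ ℚ.≟ p)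

-- Closed numerals evaluate, so `0≤ι 2` also serves as a proof of `0ℚ ≤ 2ℚ`.
2ℚ : ℚ
2ℚ = 1ℚ + 1ℚ

+-nonNeg : ∀ {p q} → 0ℚ ℚ.≤ p → 0ℚ ℚ.≤ q → 0ℚ ℚ.≤ p + q
+-nonNeg = ℚ.+-mono-≤

*-nonNeg : ∀ {p q} → 0ℚ ℚ.≤ p → 0ℚ ℚ.≤ q → 0ℚ ℚ.≤ p * q
*-nonNeg {p} {q} 0≤p 0≤q = ℚ.nonNegative⁻¹ (p * q)
  {{ℚ.nonNeg*nonNeg⇒nonNeg p {{ℚ.nonNegative 0≤p}} q {{ℚ.nonNegative 0≤q}}}}

*-pos : ∀ {p q} → 0ℚ ℚ.< p → 0ℚ ℚ.< q → 0ℚ ℚ.< p * q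
*-pos {p} {q} 0<p 0<q = ℚ.positive⁻¹ (p * q)
  {{ℚ.pos*pos⇒pos p {{ℚ.positive 0<p}} q {{ℚ.positive 0<q}}}}

*-monoˡ-≤ : ∀ {r p q} → 0ℚ ℚ.≤ r → p ℚ.≤ q → r * p ℚ.≤ r * q
*-monoˡ-≤ {r} 0≤r = ℚ.*-monoˡ-≤-nonNeg r {{ℚ.nonNegative 0≤r}}

*-monoʳ-≤ : ∀ {r p q} → 0ℚ ℚ.≤ r → p ℚ.≤ q → p * r ℚ.≤ q * r
*-monoʳ-≤ {r} 0≤r = ℚ.*-monoʳ-≤-nonNeg r {{ℚ.nonNegative 0≤r}}

*-mono-≤ : ∀ {p q r s} → 0ℚ ℚ.≤ p → 0ℚ ℚ.≤ s → p ℚ.≤ q → r ℚ.≤ s → p * r ℚ.≤ q * s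
*-mono-≤ 0≤p 0≤s p≤q r≤s = ℚ.≤-trans (*-monoˡ-≤ 0≤p r≤s) (*-monoʳ-≤ 0≤s p≤q)

*-cancelˡ-≤ : ∀ {r p q} → 0ℚ ℚ.< r → r * p ℚ.≤ r * q → p ℚ.≤ q
*-cancelˡ-≤ {r} 0<r = ℚ.*-cancelˡ-≤-pos r {{ℚ.positive 0<r}}

p≤q⇒0≤q-p : ∀ {p q} → p ℚ.≤ q → 0ℚ ℚ.≤ q - p
p≤q⇒0≤q-p {p} {q} p≤q = subst (ℚ._≤ q - p) (ℚ.+-inverseʳ p) (ℚ.+-monoˡ-≤ (- p) p≤q)

-- Polynomial inequalities are proved by exhibiting q - p as a visibly
-- non-negative expression r.
≤-from-gap : ∀ {p q r} → 0ℚ ℚ.≤ r → p + r ≡ q → p ℚ.≤ q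
≤-from-gap {p} {q} {r} 0≤r eq = subst₂ ℚ._≤_ (ℚ.+-identityʳ p) eq (ℚ.+-monoʳ-≤ p 0≤r)

0≤p² : ∀ p → 0ℚ ℚ.≤ p * p
0≤p² p with ℚ.≤-total 0ℚ p
... | inj₁ 0≤p = *-nonNeg 0≤p 0≤p
... | inj₂ p≤0 = subst (0ℚ ℚ.≤_) (neg-square p) (*-nonNeg 0≤-p 0≤-p)
  where
  0≤-p = ℚ.neg-antimono-≤ p≤0
  neg-square : ∀ p → - p * - p ≡ p * p
  neg-square = solve-∀ ringℚ

-- The gap is `l * (p - μ * q)²`. Passing the inverse `μ` of `l` as an argument keeps division out
-- of the ring identities.
am-gm : ∀ {l μ} p q → 0ℚ ℚ.≤ l → l * μ ≡ 1ℚ → 2ℚ * (p * q) ℚ.≤ l * (p * p) + μ * (q * q)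
am-gm {l} {μ} p q 0≤l lμ≡1 = ≤-from-gap (*-nonNeg 0≤l (0≤p² (p - μ * q))) eq
  where
  expand : ∀ l μ p q → 2ℚ * (p * q) + l * ((p - μ * q) * (p - μ * q)) ≡
           2ℚ * (p * q) + l * (p * p) - 2ℚ * (l * μ) * (p * q) + (l * μ) * μ * (q * q)
  expand = solve-∀ ringℚ
  collapse : ∀ l μ p q → 2ℚ * (p * q) + l * (p * p) - 2ℚ * 1ℚ * (p * q) + 1ℚ * μ * (q * q) ≡
             l * (p * p) + μ * (q * q)
  collapse = solve-∀ ringℚ
  eq = trans (expand l μ p q)
      (trans (cong (λ z → 2ℚ * (p * q) + l * (p * p) - 2ℚ * z * (p * q) + z * μ * (q * q)) lμ≡1)
             (collapse l μ p q))

ι : ℕ → ℚ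
ι k = pos k ℚ./ 1

-- `_/_` normalises by a gcd, which is stuck on a variable `k`; in the explicit form sums and
-- products compute.
ι≡mkℚ : ∀ k → ι k ≡ mkℚ (pos k) 0 (Coprimality.sym (1-coprimeTo k))
ι≡mkℚ k = ℚ.normalize-coprime (Coprimality.sym (1-coprimeTo k))

ι-+ : ∀ j k → ι (j ℕ.+ k) ≡ ι j + ι k
ι-+ j k = trans (cong (ℚ._/ 1) (cong₂ ℤ._+_ (sym (ℤ.*-identityʳ (pos j))) (sym (ℤ.*-identityʳ (pos k)))))
                (sym (cong₂ _+_ (ι≡mkℚ j) (ι≡mkℚ k)))

ι-* : ∀ j k → ι (j ℕ.* k) ≡ ι j * ι k
ι-* j k = trans (cong (ℚ._/ 1) (ℤ.pos-* j k)) (sym (cong₂ _*_ (ι≡mkℚ j) (ι≡mkℚ k)))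

ι-suc : ∀ k → ι (suc k) ≡ 1ℚ + ι k
ι-suc = ι-+ 1

0≤ι : ∀ k → 0ℚ ℚ.≤ ι k
0≤ι k = ℚ.nonNegative⁻¹ (ι k) {{ℚ.normalize-nonNeg k 1}}

ι-mono-≤ : ∀ {j k} → j ℕ.≤ k → ι j ℚ.≤ ι k
ι-mono-≤ {j} {k} j≤k = ≤-from-gap (0≤ι (k ℕ.∸ j))
  (trans (sym (ι-+ j (k ℕ.∸ j))) (cong ι (ℕ.m+[n∸m]≡n j≤k)))

0<ι-suc : ∀ k → 0ℚ ℚ.< ι (suc k)
0<ι-suc k = ℚ.positive⁻¹ (ι (suc k)) {{ℚ.normalize-pos (suc k) 1}}

ι-cancel-≤ : ∀ {j k} → ι j ℚ.≤ ι k → j ℕ.≤ k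
ι-cancel-≤ {j} {k} ιj≤ιk with j ℕ.≤? k
... | yes j≤k = j≤k
... | no  j≰k = contradiction (ℚ.<-≤-trans ιk<ιj ιj≤ιk) (ℚ.<-irrefl refl)
  where
  ιk<ιj : ι k ℚ.< ι j
  ιk<ιj = ℚ.<-≤-trans
    (subst₂ ℚ._<_ (ℚ.+-identityˡ (ι k)) (sym (ι-suc k)) (ℚ.+-monoˡ-< (ι k) (0<ι-suc 0)))
    (ι-mono-≤ (ℕ.≰⇒> j≰k))

1/suc-inverse : ∀ k → ι (suc k) * (pos 1 ℚ./ suc k) ≡ 1ℚ
1/suc-inverse k = begin
  ι (suc k) * (pos 1 ℚ./ suc k) ≡⟨ cong₂ _*_ (ι≡mkℚ (suc k)) (ℚ.normalize-coprime (1-coprimeTo (suc k))) ⟩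
  k′ * ℚ.1/ k′                  ≡⟨ ℚ.*-inverseʳ k′ ⟩
  1ℚ                            ∎
  where
  open ≡-Reasoning
  k′ = mkℚ (pos (suc k)) 0 (Coprimality.sym (1-coprimeTo (suc k)))

-- Indicators, finite sums and maxima.

𝟙 : {P : Set} → Dec P → ℚ
𝟙 P? = if does P? then 1ℚ else 0ℚ

0≤𝟙 : {P : Set} (P? : Dec P) → 0ℚ ℚ.≤ 𝟙 P?
0≤𝟙 (yes _) = 0≤ι 1
0≤𝟙 (no _)  = ℚ.≤-refl

𝟙≤1 : {P : Set} (P? : Dec P) → 𝟙 P? ℚ.≤ 1ℚ
𝟙≤1 (yes _) = ℚ.≤-refl
𝟙≤1 (no _)  = 0≤ι 1

sum-mono : {f g : Fin n → ℚ} → (∀ i → f i ℚ.≤ g i) → sum f ℚ.≤ sum g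
sum-mono {zero}  f≤g = ℚ.≤-refl
sum-mono {suc n} f≤g = ℚ.+-mono-≤ (f≤g zero) (sum-mono (f≤g ∘ suc))

sum-nonNeg : {f : Fin n → ℚ} → (∀ i → 0ℚ ℚ.≤ f i) → 0ℚ ℚ.≤ sum f
sum-nonNeg {zero}  0≤f = ℚ.≤-refl
sum-nonNeg {suc n} 0≤f = +-nonNeg (0≤f zero) (sum-nonNeg (0≤f ∘ suc))

term≤sum : {f : Fin n → ℚ} → (∀ i → 0ℚ ℚ.≤ f i) → ∀ i → f i ℚ.≤ sum f
term≤sum 0≤f zero    = ≤-from-gap (sum-nonNeg (0≤f ∘ suc)) refl
term≤sum {f = f} 0≤f (suc i) =
  ℚ.≤-trans (term≤sum (0≤f ∘ suc) i) (≤-from-gap (0≤f zero) (ℚ.+-comm (sum (f ∘ suc)) (f zero)))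

sum-const : ∀ n (p : ℚ) → sum {n} (λ _ → p) ≡ ι n * p
sum-const zero    p = sym (ℚ.*-zeroˡ p)
sum-const (suc n) p = begin
  p + sum {n} (λ _ → p) ≡⟨ cong (p +_) (sum-const n p) ⟩
  p + ι n * p           ≡⟨ distrib p (ι n) ⟩
  (1ℚ + ι n) * p        ≡⟨ cong (_* p) (ι-suc n) ⟨
  ι (suc n) * p         ∎
  where
  open ≡-Reasoning
  distrib : ∀ p k → p + k * p ≡ (1ℚ + k) * p
  distrib = solve-∀ ringℚ

sum-neg : (f : Fin n → ℚ) → sum (λ i → - f i) ≡ - sum f
sum-neg {zero}  f = refl
sum-neg {suc n} f = trans (cong (- f zero +_) (sum-neg (f ∘ suc))) (sym (ℚ.neg-distrib-+ (f zero) (sum (f ∘ suc))))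

sum-minus : (f g : Fin n → ℚ) → sum (λ i → f i - g i) ≡ sum f - sum g
sum-minus f g = trans (∑-distrib-+ f (λ i → - g i)) (cong (_+_ (sum f)) (sum-neg g))

argmax : Fin n → (f : Fin n → ℚ) → ∃[ i ] (∀ j → f j ℚ.≤ f i)
argmax {suc zero}    _ f = zero , λ { zero → ℚ.≤-refl }
argmax {suc (suc n)} _ f with argmax zero (f ∘ suc)
... | i , max with ℚ.≤-total (f zero) (f (suc i))
...   | inj₁ f0≤fi = suc i , λ { zero → f0≤fi ; (suc j) → max j }
...   | inj₂ fi≤f0 = zero , λ { zero → ℚ.≤-refl ; (suc j) → ℚ.≤-trans (max j) fi≤f0 }

sumᴸ : (A → ℚ) → List A → ℚ
sumᴸ f []       = 0ℚ
sumᴸ f (x ∷ xs) = f x + sumᴸ f xs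

sumᴸ-one : (xs : List A) → sumᴸ (λ _ → 1ℚ) xs ≡ ι (length xs)
sumᴸ-one []       = refl
sumᴸ-one (x ∷ xs) = trans (cong (1ℚ +_) (sumᴸ-one xs)) (sym (ι-suc (length xs)))

sumᴸ-filter : {P : Pred A 0ℓ} (P? : Decidable P) (f : A → ℚ) (xs : List A) →
              sumᴸ f (filter P? xs) ≡ sumᴸ (λ x → 𝟙 (P? x) * f x) xs
sumᴸ-filter P? f []       = refl
sumᴸ-filter P? f (x ∷ xs) with does (P? x)
... | true  = cong₂ _+_ (sym (ℚ.*-identityˡ (f x))) (sumᴸ-filter P? f xs)
... | false = trans (sumᴸ-filter P? f xs)
                    (sym (trans (cong (_+ sumᴸ _ xs) (ℚ.*-zeroˡ (f x))) (ℚ.+-identityˡ _)))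

sumᴸ-tabulate : (f : A → ℚ) (g : Fin n → A) → sumᴸ f (tabulate g) ≡ sum (f ∘ g)
sumᴸ-tabulate {n = zero}  f g = refl
sumᴸ-tabulate {n = suc n} f g = cong (f (g zero) +_) (sumᴸ-tabulate f (g ∘ suc))

sumᴸ-filter-allFin : {P : Pred (Fin n) 0ℓ} (P? : Decidable P) (f : Fin n → ℚ) →
                     sumᴸ f (filter P? (allFin n)) ≡ sum (λ i → 𝟙 (P? i) * f i)
sumᴸ-filter-allFin P? f = trans (sumᴸ-filter P? f (allFin _)) (sumᴸ-tabulate (λ i → 𝟙 (P? i) * f i) id)

-- Expectations

-- `𝔼` only takes natural-valued functions; `E d (ι ∘ f)` unfolds to `𝔼 d f`.
E : Dist A → (A → ℚ) → ℚ
E d f = List.foldr (λ (p , a) e → p * f a + e) 0ℚ d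

E-cong : (d : Dist A) {f g : A → ℚ} → (∀ a → f a ≡ g a) → E d f ≡ E d g
E-cong []            f≗g = refl
E-cong ((p , a) ∷ d) f≗g = cong₂ _+_ (cong (p *_) (f≗g a)) (E-cong d f≗g)

E-+ : (d : Dist A) (f g : A → ℚ) → E d (λ a → f a + g a) ≡ E d f + E d g
E-+ []            f g = refl
E-+ ((p , a) ∷ d) f g = trans (cong (p * (f a + g a) +_) (E-+ d f g)) (regroup p (f a) (g a) (E d f) (E d g))
  where
  regroup : ∀ p x y u v → p * (x + y) + (u + v) ≡ (p * x + u) + (p * y + v)
  regroup = solve-∀ ringℚ

E-*ˡ : (d : Dist A) (c : ℚ) (f : A → ℚ) → E d (λ a → c * f a) ≡ c * E d f
E-*ˡ []            c f = sym (ℚ.*-zeroʳ c)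
E-*ˡ ((p , a) ∷ d) c f = trans (cong (p * (c * f a) +_) (E-*ˡ d c f)) (regroup p c (f a) (E d f))
  where
  regroup : ∀ p c x u → p * (c * x) + c * u ≡ c * (p * x + u)
  regroup = solve-∀ ringℚ

E-sum : (d : Dist A) (f : Fin n → A → ℚ) → E d (λ a → sum (λ i → f i a)) ≡ sum (λ i → E d (f i))
E-sum {n = zero}  d f = trans (E-*ˡ d 0ℚ (λ _ → 0ℚ)) (ℚ.*-zeroˡ (E d (λ _ → 0ℚ)))
E-sum {n = suc n} d f = trans (E-+ d (f zero) _) (cong (E d (f zero) +_) (E-sum d (f ∘ suc)))

E-++ : (d e : Dist A) (f : A → ℚ) → E (d ++ e) f ≡ E d f + E e f
E-++ []            e f = sym (ℚ.+-identityˡ (E e f))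
E-++ ((p , a) ∷ d) e f = trans (cong (p * f a +_) (E-++ d e f)) (sym (ℚ.+-assoc (p * f a) (E d f) (E e f)))

E-scale : (c : ℚ) (d : Dist A) (f : A → ℚ) → E (List.map (map₁ (c *_)) d) f ≡ c * E d f
E-scale c []            f = sym (ℚ.*-zeroʳ c)
E-scale c ((p , a) ∷ d) f = trans (cong (c * p * f a +_) (E-scale c d f)) (regroup c p (f a) (E d f))
  where
  regroup : ∀ c p x u → c * p * x + c * u ≡ c * (p * x + u)
  regroup = solve-∀ ringℚ

E->>= : (d : Dist A) (k : A → Dist B) (f : B → ℚ) → E (d >>= k) f ≡ E d (λ a → E (k a) f)
E->>= []            k f = refl
E->>= ((p , a) ∷ d) k f =
  trans (E-++ (List.map (map₁ (p *_)) (k a)) (d >>= k) f) (cong₂ _+_ (E-scale p (k a) f) (E->>= d k f))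

E-mapᴰ : (g : A → B) (d : Dist A) (f : B → ℚ) → E (mapᴰ g d) f ≡ E d (f ∘ g)
E-mapᴰ g []            f = refl
E-mapᴰ g ((p , a) ∷ d) f = cong (p * f (g a) +_) (E-mapᴰ g d f)

E-return : (a : A) (f : A → ℚ) → E (return a) f ≡ f a
E-return a f = trans (ℚ.+-identityʳ (1ℚ * f a)) (ℚ.*-identityˡ (f a))

-- Non-negativity of the weights enters only through its consequence `monotone`; in this form,
-- closure under `_>>=_` and `mapᴰ` follows from the formulas for `E`.
record IsProbability (d : Dist A) : Set where
  field
    monotone : {f g : A → ℚ} → (∀ a → f a ℚ.≤ g a) → E d f ℚ.≤ E d g
    total    : E d (λ _ → 1ℚ) ≡ 1ℚ

  E-const : ∀ c → E d (λ _ → c) ≡ c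
  E-const c = begin
    E d (λ _ → c)          ≡⟨ E-cong d (λ _ → sym (ℚ.*-identityʳ c)) ⟩
    E d (λ _ → c * 1ℚ)     ≡⟨ E-*ˡ d c (λ _ → 1ℚ) ⟩
    c * E d (λ _ → 1ℚ)     ≡⟨ cong (c *_) total ⟩
    c * 1ℚ                 ≡⟨ ℚ.*-identityʳ c ⟩
    c                      ∎
    where open ≡-Reasoning

open IsProbability

return-isProbability : (a : A) → IsProbability (return a)
return-isProbability a .monotone {f} {g} f≤g = subst₂ ℚ._≤_ (sym (E-return a f)) (sym (E-return a g)) (f≤g a)
return-isProbability a .total = refl

>>=-isProbability : {d : Dist A} {k : A → Dist B} → IsProbability d → (∀ a → IsProbability (k a)) →
                    IsProbability (d >>= k)
>>=-isProbability {d = d} {k} dp kp .monotone {f} {g} f≤g =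
  subst₂ ℚ._≤_ (sym (E->>= d k f)) (sym (E->>= d k g)) (dp .monotone λ a → kp a .monotone f≤g)
>>=-isProbability {d = d} {k} dp kp .total =
  trans (E->>= d k (λ _ → 1ℚ)) (trans (E-cong d (λ a → kp a .total)) (dp .total))

mapᴰ-isProbability : {d : Dist A} (g : A → B) → IsProbability d → IsProbability (mapᴰ g d)
mapᴰ-isProbability {d = d} g dp .monotone {f} {h} f≤h =
  subst₂ ℚ._≤_ (sym (E-mapᴰ g d f)) (sym (E-mapᴰ g d h)) (dp .monotone (f≤h ∘ g))
mapᴰ-isProbability {d = d} g dp .total = trans (E-mapᴰ g d (λ _ → 1ℚ)) (dp .total)

E-uniform : (x : A) (xs : List A) (f : A → ℚ) →
            E (uniform (x ∷ xs)) f ≡ (pos 1 ℚ./ suc (length xs)) * sumᴸ f (x ∷ xs)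
E-uniform x xs f = weighted (pos 1 ℚ./ suc (length xs)) (x ∷ xs)
  where
  weighted : ∀ p ys → E (List.map (p ,_) ys) f ≡ p * sumᴸ f ys
  weighted p []       = sym (ℚ.*-zeroʳ p)
  weighted p (y ∷ ys) = trans (cong (p * f y +_) (weighted p ys)) (sym (ℚ.*-distribˡ-+ p (f y) (sumᴸ f ys)))

sumᴸ-mono : {f g : A → ℚ} → (∀ a → f a ℚ.≤ g a) → ∀ xs → sumᴸ f xs ℚ.≤ sumᴸ g xs
sumᴸ-mono f≤g []       = ℚ.≤-refl
sumᴸ-mono f≤g (x ∷ xs) = ℚ.+-mono-≤ (f≤g x) (sumᴸ-mono f≤g xs)

length*E-uniform : (xs : List A) → 0 ℕ.< length xs → (f : A → ℚ) →
                   ι (length xs) * E (uniform xs) f ≡ sumᴸ f xs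
length*E-uniform (x ∷ xs) _ f = begin
  ι (suc k) * E (uniform (x ∷ xs)) f                   ≡⟨ cong (ι (suc k) *_) (E-uniform x xs f) ⟩
  ι (suc k) * ((pos 1 ℚ./ suc k) * sumᴸ f (x ∷ xs))      ≡⟨ ℚ.*-assoc (ι (suc k)) _ _ ⟨
  ι (suc k) * (pos 1 ℚ./ suc k) * sumᴸ f (x ∷ xs)        ≡⟨ cong (_* sumᴸ f (x ∷ xs)) (1/suc-inverse k) ⟩
  1ℚ * sumᴸ f (x ∷ xs)                                 ≡⟨ ℚ.*-identityˡ _ ⟩
  sumᴸ f (x ∷ xs)                                      ∎
  where
  open ≡-Reasoning
  k = length xs

uniform-isProbability : (xs : List A) → 0 ℕ.< length xs → IsProbability (uniform xs)
uniform-isProbability (x ∷ xs) 0<∣xs∣ .monotone {f} {g} f≤g =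
  *-cancelˡ-≤ (0<ι-suc (length xs))
    (subst₂ ℚ._≤_ (sym (length*E-uniform (x ∷ xs) 0<∣xs∣ f)) (sym (length*E-uniform (x ∷ xs) 0<∣xs∣ g))
      (sumᴸ-mono f≤g (x ∷ xs)))
uniform-isProbability (x ∷ xs) _ .total = begin
  E (uniform (x ∷ xs)) (λ _ → 1ℚ)                               ≡⟨ E-uniform x xs (λ _ → 1ℚ) ⟩
  (pos 1 ℚ./ suc (length xs)) * sumᴸ (λ _ → 1ℚ) (x ∷ xs)          ≡⟨ cong ((pos 1 ℚ./ suc (length xs)) *_) (sumᴸ-one (x ∷ xs)) ⟩
  (pos 1 ℚ./ suc (length xs)) * ι (suc (length xs))               ≡⟨ ℚ.*-comm (pos 1 ℚ./ suc (length xs)) (ι (suc (length xs))) ⟩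
  ι (suc (length xs)) * (pos 1 ℚ./ suc (length xs))               ≡⟨ 1/suc-inverse (length xs) ⟩
  1ℚ                                                            ∎
  where open ≡-Reasoning

E-trajectory : {S : Set} (step : S → Dist S) (N : ℕ) (s : S) (f : _ → ℚ) →
  E (trajectory step (suc N) s) f ≡ E (step s) (λ s′ → E (trajectory step N s′) (λ ω → f (s Vec.∷ ω)))
E-trajectory step N s f = trans (E->>= (step s) _ f)
  (E-cong (step s) λ s′ → E-mapᴰ _ (trajectory step N s′) f)

trajectory-isProbability : {S : Set} {step : S → Dist S} → (∀ s → IsProbability (step s)) →
                           ∀ N s → IsProbability (trajectory step N s)
trajectory-isProbability stepp zero    s = return-isProbability _
trajectory-isProbability stepp (suc N) s =
  >>=-isProbability (stepp s) (λ s′ → mapᴰ-isProbability _ (trajectory-isProbability stepp N s′))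

inverse : ∀ {p} → 0ℚ ℚ.< p → ∃[ q ] 0ℚ ℚ.< q × q * p ≡ 1ℚ
inverse {p} 0<p = (ℚ.1/ p) , ℚ.positive⁻¹ (ℚ.1/ p) {{ℚ.1/pos⇒pos p}} , ℚ.*-inverseˡ p
  where
  instance
    _ = ℚ.positive 0<p
    _ = ℚ.pos⇒nonZero p

archimedean : ∀ p → ∃[ k ] p ℚ.≤ ι k
archimedean p@(mkℚ i d-1 _) = ℤ.∣ i ∣ , subst (p ℚ.≤_) (sym (ι≡mkℚ ℤ.∣ i ∣)) (ℚ.*≤* le)
  where
  le : i ℤ.* pos 1 ℤ.≤ pos ℤ.∣ i ∣ ℤ.* pos (suc d-1)
  le = ℤ.≤-trans (ℤ.≤-reflexive (ℤ.*-identityʳ i))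
      (ℤ.≤-trans (i≤∣i∣ i)
      (ℤ.≤-trans (ℤ.+≤+ (ℕ.m≤m*n ℤ.∣ i ∣ (suc d-1))) (ℤ.≤-reflexive (ℤ.pos-* ℤ.∣ i ∣ (suc d-1)))))
    where
    i≤∣i∣ : ∀ i → i ℤ.≤ pos ℤ.∣ i ∣
    i≤∣i∣ (ℤ.+_ k)     = ℤ.≤-refl
    i≤∣i∣ ℤ.-[1+ k ] = ℤ.-≤+

sum-single : (t : Fin n) (c : ℚ) → sum (λ x → 𝟙 (x Fin.≟ t) * c) ≡ c
sum-single {suc n} zero c = trans (cong₂ _+_ (ℚ.*-identityˡ c) rest) (ℚ.+-identityʳ c)
  where
  rest : sum {n} (λ _ → 0ℚ * c) ≡ 0ℚ
  rest = trans (sum-const n (0ℚ * c)) (trans (cong (ι n *_) (ℚ.*-zeroˡ c)) (ℚ.*-zeroʳ (ι n)))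
sum-single {suc n} (suc t) c =
  trans (cong₂ _+_ (ℚ.*-zeroˡ c) (sum-single t c)) (ℚ.+-identityˡ c)

-- Dirichlet forms

module Dirichlet {n} (w : Fin n → Fin n → ℚ) (0≤w : ∀ x y → 0ℚ ℚ.≤ w x y)
                 (w-sym : ∀ x y → w x y ≡ w y x) where

  -- The unnormalised Laplacian; for adjacency weights it equals `d x * (f x - P f x)`, which ties
  -- the energy to the walk.
  L : (Fin n → ℚ) → Fin n → ℚ
  L f x = sum λ y → w x y * (f x - f y)

  -- The sum runs over ordered pairs, so every edge is counted twice.
  𝓔 : (Fin n → ℚ) → (Fin n → ℚ) → ℚ
  𝓔 f g = sum λ x → sum λ y → w x y * ((f x - f y) * (g x - g y))

  L-expand : ∀ f x → L f x ≡ sum (w x) * f x - sum (λ y → w x y * f y)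
  L-expand f x = begin
    sum (λ y → w x y * (f x - f y))               ≡⟨ sum-cong-≗ (λ y → expand (w x y) (f x) (f y)) ⟩
    sum (λ y → w x y * f x - w x y * f y)         ≡⟨ sum-minus (λ y → w x y * f x) (λ y → w x y * f y) ⟩
    sum (λ y → w x y * f x) - sum (λ y → w x y * f y)
      ≡⟨ cong (_- sum (λ y → w x y * f y)) (*-distribʳ-sum (f x) (w x)) ⟨
    sum (w x) * f x - sum (λ y → w x y * f y)     ∎
    where
    open ≡-Reasoning
    expand : ∀ a b c → a * (b - c) ≡ a * b - a * c
    expand = solve-∀ ringℚ

  -- Summation by parts: each ordered pair splits into a term with `g x` and one with `g y`, and
  -- symmetry of `w` makes the two totals equal.
  𝓔-L : ∀ f g → 𝓔 f g ≡ 2ℚ * sum (λ x → g x * L f x)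
  𝓔-L f g = begin
    𝓔 f g                                        ≡⟨ sum-cong-≗ (λ x → trans (sum-cong-≗ (split x)) (∑-distrib-+ (a x) (λ y → a y x))) ⟩
    sum (λ x → sum (a x) + sum (λ y → a y x))    ≡⟨ ∑-distrib-+ (λ x → sum (a x)) (λ x → sum (λ y → a y x)) ⟩
    S + sum (λ x → sum (λ y → a y x))            ≡⟨ cong (S +_) (∑-comm a) ⟨
    S + S                                        ≡⟨ double S ⟩
    2ℚ * S                                       ≡⟨ cong (2ℚ *_) (sum-cong-≗ λ x → *-distribˡ-sum (g x) (λ y → w x y * (f x - f y))) ⟨
    2ℚ * sum (λ x → g x * L f x)                 ∎
    where
    open ≡-Reasoning
    a : Fin n → Fin n → ℚ
    a x y = g x * (w x y * (f x - f y))
    S = sum λ x → sum (a x)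
    double : ∀ s → s + s ≡ 2ℚ * s
    double = solve-∀ ringℚ
    regroup : ∀ w a b c d → w * ((a - b) * (c - d)) ≡ c * (w * (a - b)) + d * (w * (b - a))
    regroup = solve-∀ ringℚ
    split : ∀ x y → w x y * ((f x - f y) * (g x - g y)) ≡ a x y + a y x
    split x y = trans (regroup (w x y) (f x) (f y) (g x) (g y))
                      (cong (λ v → a x y + g y * (v * (f y - f x))) (w-sym x y))

  *-distribˡ-sum² : ∀ c (a : Fin n → Fin n → ℚ) → c * sum (λ x → sum (a x)) ≡ sum (λ x → sum (λ y → c * a x y))
  *-distribˡ-sum² c a = trans (*-distribˡ-sum c (λ x → sum (a x))) (sum-cong-≗ λ x → *-distribˡ-sum c (a x))

  𝓔-am-gm : ∀ {l μ} f g → 0ℚ ℚ.≤ l → l * μ ≡ 1ℚ → 2ℚ * 𝓔 f g ℚ.≤ l * 𝓔 f f + μ * 𝓔 g g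
  𝓔-am-gm {l} {μ} f g 0≤l lμ≡1 = begin
    2ℚ * 𝓔 f g  ≡⟨ *-distribˡ-sum² 2ℚ (λ x y → w x y * (df x y * dg x y)) ⟩
    sum (λ x → sum (λ y → 2ℚ * (w x y * (df x y * dg x y))))
      ≤⟨ sum-mono (λ x → sum-mono (λ y → termwise x y)) ⟩
    sum (λ x → sum (λ y → l * (w x y * (df x y * df x y)) + μ * (w x y * (dg x y * dg x y))))
      ≡⟨ sum-cong-≗ (λ x → ∑-distrib-+ (λ y → l * (w x y * (df x y * df x y))) (λ y → μ * (w x y * (dg x y * dg x y)))) ⟩
    sum (λ x → sum (λ y → l * (w x y * (df x y * df x y))) + sum (λ y → μ * (w x y * (dg x y * dg x y))))
      ≡⟨ ∑-distrib-+ (λ x → sum (λ y → l * (w x y * (df x y * df x y)))) (λ x → sum (λ y → μ * (w x y * (dg x y * dg x y)))) ⟩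
    sum (λ x → sum (λ y → l * (w x y * (df x y * df x y)))) + sum (λ x → sum (λ y → μ * (w x y * (dg x y * dg x y))))
      ≡⟨ cong₂ _+_ (*-distribˡ-sum² l (λ x y → w x y * (df x y * df x y))) (*-distribˡ-sum² μ (λ x y → w x y * (dg x y * dg x y))) ⟨
    l * 𝓔 f f + μ * 𝓔 g g  ∎
    where
    open ℚ.≤-Reasoning
    df dg : Fin n → Fin n → ℚ
    df x y = f x - f y
    dg x y = g x - g y
    pull : ∀ w c a → w * (c * a) ≡ c * (w * a)
    pull = solve-∀ ringℚ
    distrib : ∀ w l a μ b → w * (l * a + μ * b) ≡ l * (w * a) + μ * (w * b)
    distrib = solve-∀ ringℚ
    termwise : ∀ x y → 2ℚ * (w x y * (df x y * dg x y)) ℚ.≤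
                       l * (w x y * (df x y * df x y)) + μ * (w x y * (dg x y * dg x y))
    termwise x y = subst₂ ℚ._≤_ (pull (w x y) 2ℚ (df x y * dg x y))
      (distrib (w x y) l (df x y * df x y) μ (dg x y * dg x y))
      (*-monoˡ-≤ (0≤w x y) (am-gm (df x y) (dg x y) 0≤l lμ≡1))

  edge≤𝓔 : ∀ f x y → w x y * ((f x - f y) * (f x - f y)) ℚ.≤ 𝓔 f f
  edge≤𝓔 f x y = ℚ.≤-trans (term≤sum (nonNeg x) y) (term≤sum (λ z → sum-nonNeg (nonNeg z)) x)
    where
    nonNeg : ∀ x y → 0ℚ ℚ.≤ w x y * ((f x - f y) * (f x - f y))
    nonNeg x y = *-nonNeg (0≤w x y) (0≤p² (f x - f y))

  ∑L≡0 : ∀ f → sum (L f) ≡ 0ℚ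
  ∑L≡0 f = begin
    sum (L f)                                    ≡⟨ sum-cong-≗ (λ x → L-expand f x) ⟩
    sum (λ x → sum (w x) * f x - sum (λ y → w x y * f y))
      ≡⟨ sum-minus (λ x → sum (w x) * f x) (λ x → sum (λ y → w x y * f y)) ⟩
    sum (λ x → sum (w x) * f x) - sum (λ x → sum (λ y → w x y * f y))
      ≡⟨ cong (_-_ (sum (λ x → sum (w x) * f x))) swap ⟩
    sum (λ x → sum (w x) * f x) - sum (λ x → sum (w x) * f x)
      ≡⟨ ℚ.+-inverseʳ (sum (λ x → sum (w x) * f x)) ⟩
    0ℚ                                           ∎
    where
    open ≡-Reasoning
    swap : sum (λ x → sum (λ y → w x y * f y)) ≡ sum (λ x → sum (w x) * f x)
    swap = trans (∑-comm (λ x y → w x y * f y)) (sum-cong-≗ λ y →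
      trans (sum-cong-≗ (λ x → cong (_* f y) (w-sym x y))) (sym (*-distribʳ-sum (f y) (w y))))

-- First times on finite paths.

least≤ : ∀ {N} {P : Pred (Fin N) 0ℓ} (P? : Decidable P) → least P? ℕ.≤ N
least≤ {zero}  P? = ℕ.z≤n
least≤ {suc N} P? with does (P? zero)
... | true  = ℕ.z≤n
... | false = ℕ.s≤s (least≤ (P? ∘ suc))

least-minimal : ∀ {N} {P : Pred (Fin N) 0ℓ} (P? : Decidable P) {i} → P i → least P? ℕ.≤ Fin.toℕ i
least-minimal P? {zero}  p rewrite dec-true (P? zero) p = ℕ.z≤n
least-minimal P? {suc i} p with does (P? zero)
... | true  = ℕ.z≤n
... | false = ℕ.s≤s (least-minimal (P? ∘ suc) p)

-- The condition `k ≤ N` accounts for the default value `N`, taken when `P` never holds.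
least-greatest : ∀ {N} {P : Pred (Fin N) 0ℓ} (P? : Decidable P) {k} → k ℕ.≤ N →
                 (∀ i → P i → k ℕ.≤ Fin.toℕ i) → k ℕ.≤ least P?
least-greatest {zero}  P? k≤N lower = k≤N
least-greatest {suc N} P? k≤N lower with P? zero
... | yes p = lower zero p
least-greatest {suc N} P? {zero}  k≤N lower | no _ = ℕ.z≤n
least-greatest {suc N} P? {suc k} k≤N lower | no _ =
  ℕ.s≤s (least-greatest (P? ∘ suc) (ℕ.≤-pred k≤N) (λ i p → ℕ.≤-pred (lower (suc i) p)))

-- Random walks

module RandomWalk {n} (G : Graph n) (degree>0 : ∀ x → 0 ℕ.< degree G x) where
  open Graph G

  adj : Fin n → Fin n → ℚ
  adj x y = 𝟙 (x ~? y)

  0≤adj : ∀ x y → 0ℚ ℚ.≤ adj x y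
  0≤adj x y = 0≤𝟙 (x ~? y)

  adj-sym : ∀ x y → adj x y ≡ adj y x
  adj-sym x y with x ~? y | y ~? x
  ... | yes _   | yes _   = refl
  ... | no _    | no _    = refl
  ... | yes x~y | no y≁x  = contradiction (~-sym x~y) y≁x
  ... | no x≁y  | yes y~x = contradiction (~-sym y~x) x≁y

  open Dirichlet adj 0≤adj adj-sym public

  d : Fin n → ℚ
  d x = ι (degree G x)

  vol : ℚ
  vol = sum d

  0≤d : ∀ x → 0ℚ ℚ.≤ d x
  0≤d x = 0≤ι (degree G x)

  d≥1 : ∀ x → 1ℚ ℚ.≤ d x
  d≥1 x = ι-mono-≤ (degree>0 x)

  d>0 : ∀ x → 0ℚ ℚ.< d x
  d>0 x = ℚ.<-≤-trans (0<ι-suc 0) (d≥1 x)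

  d≡∑adj : ∀ x → d x ≡ sum (adj x)
  d≡∑adj x = begin
    ι (length (neighbours G x))          ≡⟨ sumᴸ-one (neighbours G x) ⟨
    sumᴸ (λ _ → 1ℚ) (neighbours G x)     ≡⟨ sumᴸ-filter-allFin (x ~?_) (λ _ → 1ℚ) ⟩
    sum (λ y → adj x y * 1ℚ)             ≡⟨ sum-cong-≗ (λ y → ℚ.*-identityʳ (adj x y)) ⟩
    sum (adj x)                          ∎
    where open ≡-Reasoning

  walkStep-isProbability : ∀ x → IsProbability (walkStep G x)
  walkStep-isProbability x = uniform-isProbability (neighbours G x) (degree>0 x)

  P : (Fin n → ℚ) → Fin n → ℚ
  P f x = E (walkStep G x) f

  d*P : ∀ f x → d x * P f x ≡ sum (λ y → adj x y * f y)
  d*P f x = trans (length*E-uniform (neighbours G x) (degree>0 x) f) (sumᴸ-filter-allFin (x ~?_) f)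

  module Hitting (t : Fin n) where

    -- U k x is the expectation of min(T , k), where T is the hitting time of t
    -- from x, and V k x is the probability of T > k.
    U V : ℕ → Fin n → ℚ
    U zero    x = 0ℚ
    U (suc k) x = if does (x Fin.≟ t) then 0ℚ else 1ℚ + P (U k) x
    V zero    x = if does (x Fin.≟ t) then 0ℚ else 1ℚ
    V (suc k) x = if does (x Fin.≟ t) then 0ℚ else P (V k) x

    hits : ∀ {N} → Vec (Fin n) N → ℕ
    hits ω = least (λ i → lookup ω i Fin.≟ t)

    -- A trajectory of `N` steps lists `N + 1` states, so `hits` is min(T , N + 1); hence the index
    -- `suc N`.
    U≡E-hits : ∀ N x → U (suc N) x ≡ E (trajectory (walkStep G) N x) (ι ∘ hits)
    U≡E-hits zero x = trans base (sym (E-return (x Vec.∷ Vec.[]) (ι ∘ hits)))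
      where
      base : U 1 x ≡ ι (hits (x Vec.∷ Vec.[]))
      base with does (x Fin.≟ t)
      ... | true  = refl
      ... | false = trans (cong (1ℚ +_) (E-const (walkStep-isProbability x) 0ℚ)) (ℚ.+-identityʳ 1ℚ)
    U≡E-hits (suc N) x = trans step (sym (E-trajectory (walkStep G) N x (ι ∘ hits)))
      where
      open ≡-Reasoning
      tr = trajectory (walkStep G) N
      tr-isP = trajectory-isProbability walkStep-isProbability N
      step : U (2 ℕ.+ N) x ≡ E (walkStep G x) (λ y → E (tr y) (λ ω → ι (hits (x Vec.∷ ω))))
      step with does (x Fin.≟ t)
      ... | true  = sym (trans (E-cong (walkStep G x) λ y → E-const (tr-isP y) 0ℚ)
                               (E-const (walkStep-isProbability x) 0ℚ))
      ... | false = sym (begin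
        E (walkStep G x) (λ y → E (tr y) (λ ω → ι (suc (hits ω))))
          ≡⟨ E-cong (walkStep G x) (λ y → trans (E-cong (tr y) (λ ω → ι-suc (hits ω)))
               (trans (E-+ (tr y) (λ _ → 1ℚ) (ι ∘ hits)) (cong₂ _+_ (total (tr-isP y)) (sym (U≡E-hits N y))))) ⟩
        E (walkStep G x) (λ y → 1ℚ + U (suc N) y)
          ≡⟨ E-+ (walkStep G x) (λ _ → 1ℚ) (U (suc N)) ⟩
        E (walkStep G x) (λ _ → 1ℚ) + P (U (suc N)) x
          ≡⟨ cong (_+ P (U (suc N)) x) (total (walkStep-isProbability x)) ⟩
        1ℚ + P (U (suc N)) x ∎)

    -- A covered path has visited `t`, and if the path is never covered, the default value of the
    -- cover time is the largest value `hits` can take.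
    hits≤cover : ∀ {N} (ω : Vec (Fin n) N) → hits ω ℕ.≤ least (covered? G ω)
    hits≤cover ω = least-greatest (covered? G ω) (least≤ (λ i → lookup ω i Fin.≟ t)) λ i cov →
      let j , j≤i , ωj≡t = cov t in ℕ.≤-trans (least-minimal (λ i → lookup ω i Fin.≟ t) ωj≡t) j≤i

    U≤E-cover : ∀ N x → U (suc N) x ℚ.≤ 𝔼 (trajectory (walkStep G) N x) (λ ω → least (covered? G ω))
    U≤E-cover N x = subst (ℚ._≤ 𝔼 tr (λ ω → least (covered? G ω))) (sym (U≡E-hits N x))
      (monotone (trajectory-isProbability walkStep-isProbability N x) (λ ω → ι-mono-≤ (hits≤cover ω)))
      where tr = trajectory (walkStep G) N x

    U-target : ∀ k → U k t ≡ 0ℚ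
    U-target zero    = refl
    U-target (suc k) rewrite dec-true (t Fin.≟ t) refl = refl

    P-nonNeg : ∀ {f} → (∀ y → 0ℚ ℚ.≤ f y) → ∀ x → 0ℚ ℚ.≤ P f x
    P-nonNeg {f} 0≤f x = subst (ℚ._≤ P f x) (E-const (walkStep-isProbability x) 0ℚ) (monotone (walkStep-isProbability x) 0≤f)

    V-nonNeg : ∀ k x → 0ℚ ℚ.≤ V k x
    V-nonNeg zero x with does (x Fin.≟ t)
    ... | true  = ℚ.≤-refl
    ... | false = 0≤ι 1
    V-nonNeg (suc k) x with does (x Fin.≟ t)
    ... | true  = ℚ.≤-refl
    ... | false = P-nonNeg (V-nonNeg k) x

    V-zero≤1 : ∀ x → V 0 x ℚ.≤ 1ℚ
    V-zero≤1 x with does (x Fin.≟ t)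
    ... | true  = 0≤ι 1
    ... | false = ℚ.≤-refl

    V-antitone : ∀ k x → V (suc k) x ℚ.≤ V k x
    V-antitone zero x with does (x Fin.≟ t)
    ... | true  = ℚ.≤-refl
    ... | false = subst (P (V 0) x ℚ.≤_) (total (walkStep-isProbability x)) (monotone (walkStep-isProbability x) V-zero≤1)
    V-antitone (suc k) x with does (x Fin.≟ t)
    ... | true  = ℚ.≤-refl
    ... | false = monotone (walkStep-isProbability x) (V-antitone k)

    -- The tail-sum formula E min(T , k + 1) = E min(T , k) + P(T > k), read off from the two
    -- recursions.
    U-suc : ∀ k x → U (suc k) x ≡ U k x + V k x
    U-suc zero x with does (x Fin.≟ t)
    ... | true  = refl
    ... | false = trans (cong (1ℚ +_) (E-const (walkStep-isProbability x) 0ℚ)) (ℚ.+-comm 1ℚ 0ℚ)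
    U-suc (suc k) x with does (x Fin.≟ t)
    ... | true  = refl
    ... | false = begin
      1ℚ + P (U (suc k)) x                ≡⟨ cong (1ℚ +_) (E-cong (walkStep G x) (U-suc k)) ⟩
      1ℚ + P (λ y → U k y + V k y) x      ≡⟨ cong (1ℚ +_) (E-+ (walkStep G x) (U k) (V k)) ⟩
      1ℚ + (P (U k) x + P (V k) x)        ≡⟨ ℚ.+-assoc 1ℚ (P (U k) x) (P (V k) x) ⟨
      1ℚ + P (U k) x + P (V k) x          ∎
      where open ≡-Reasoning

    U-nonNeg : ∀ k x → 0ℚ ℚ.≤ U k x
    U-nonNeg zero    x = ℚ.≤-refl
    U-nonNeg (suc k) x = subst (0ℚ ℚ.≤_) (sym (U-suc k x)) (+-nonNeg (U-nonNeg k x) (V-nonNeg k x))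

    -- Markov's inequality: by `U-suc`, `U k x` is the sum of the `V j x` with j < k, and each is at
    -- least `V k x`.
    k*V≤U : ∀ k x → ι k * V k x ℚ.≤ U k x
    k*V≤U zero    x = ℚ.≤-reflexive (ℚ.*-zeroˡ (V 0 x))
    k*V≤U (suc k) x = begin
      ι (suc k) * V (suc k) x  ≤⟨ *-monoˡ-≤ (0≤ι (suc k)) (V-antitone k x) ⟩
      ι (suc k) * V k x        ≡⟨ cong (_* V k x) (ι-suc k) ⟩
      (1ℚ + ι k) * V k x       ≡⟨ distrib (ι k) (V k x) ⟩
      ι k * V k x + V k x      ≤⟨ ℚ.+-monoˡ-≤ (V k x) (k*V≤U k x) ⟩
      U k x + V k x            ≡⟨ U-suc k x ⟨
      U (suc k) x              ∎
      where
      open ℚ.≤-Reasoning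
      distrib : ∀ a b → (1ℚ + a) * b ≡ a * b + b
      distrib = solve-∀ ringℚ

    U-off : ∀ k x → x ≢ t → U (suc k) x ≡ 1ℚ + P (U k) x
    U-off k x x≢t rewrite dec-false (x Fin.≟ t) x≢t = refl

    -- Without truncation the Laplacian of the hitting times off `t` would be exactly the degree;
    -- stopping at `k` costs the factor `1ℚ - V k x`.
    LU : ∀ k x → x ≢ t → L (U k) x ≡ d x * (1ℚ - V k x)
    LU k x x≢t = begin
      L (U k) x                                           ≡⟨ L-expand (U k) x ⟩
      sum (adj x) * U k x - sum (λ y → adj x y * U k y)   ≡⟨ cong₂ (λ a b → a * U k x - b) (sym (d≡∑adj x)) (sym (d*P (U k) x)) ⟩
      d x * U k x - d x * P (U k) x                       ≡⟨ factor (d x) (U k x) (P (U k) x) ⟩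
      d x * (1ℚ + U k x - (1ℚ + P (U k) x))               ≡⟨ cong (λ z → d x * (1ℚ + U k x - z)) (trans (sym (U-off k x x≢t)) (U-suc k x)) ⟩
      d x * (1ℚ + U k x - (U k x + V k x))                ≡⟨ cancel (d x) (U k x) (V k x) ⟩
      d x * (1ℚ - V k x)                                  ∎
      where
      open ≡-Reasoning
      factor : ∀ d u p → d * u - d * p ≡ d * (1ℚ + u - (1ℚ + p))
      factor = solve-∀ ringℚ
      cancel : ∀ d u v → d * (1ℚ + u - (u + v)) ≡ d * (1ℚ - v)
      cancel = solve-∀ ringℚ

    LU≤d : ∀ k x → x ≢ t → L (U k) x ℚ.≤ d x
    LU≤d k x x≢t = subst (ℚ._≤ d x) (sym (LU k x x≢t)) (≤-from-gap (*-nonNeg (0≤d x) (V-nonNeg k x)) (cancel (d x) (V k x)))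
      where
      cancel : ∀ d v → d * (1ℚ - v) + d * v ≡ d
      cancel = solve-∀ ringℚ

    -- By `𝓔-L` only values of `U k x * L (U k) x` matter. At `t`, where `LU≤d` says nothing, the
    -- factor `U k t` vanishes.
    𝓔UU≤ : ∀ k {b} → (∀ x → U k x ℚ.≤ b) → 𝓔 (U k) (U k) ℚ.≤ 2ℚ * (vol * b)
    𝓔UU≤ k {b} U≤b = begin
      𝓔 (U k) (U k)                            ≡⟨ 𝓔-L (U k) (U k) ⟩
      2ℚ * sum (λ x → U k x * L (U k) x)       ≤⟨ *-monoˡ-≤ (0≤ι 2) (sum-mono termwise) ⟩
      2ℚ * sum (λ x → d x * b)                 ≡⟨ cong (2ℚ *_) (*-distribʳ-sum b d) ⟨
      2ℚ * (vol * b)                           ∎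
      where
      open ℚ.≤-Reasoning
      0≤b : 0ℚ ℚ.≤ b
      0≤b = ℚ.≤-trans (U-nonNeg k t) (U≤b t)
      termwise : ∀ x → U k x * L (U k) x ℚ.≤ d x * b
      termwise x with x Fin.≟ t
      ... | yes refl = begin
        U k x * L (U k) x  ≡⟨ cong (_* L (U k) x) (U-target k) ⟩
        0ℚ * L (U k) x     ≡⟨ ℚ.*-zeroˡ (L (U k) x) ⟩
        0ℚ                 ≤⟨ *-nonNeg (0≤d x) 0≤b ⟩
        d x * b            ∎
      ... | no x≢t = begin
        U k x * L (U k) x  ≤⟨ *-monoˡ-≤ (U-nonNeg k x) (LU≤d k x x≢t) ⟩
        U k x * d x        ≤⟨ *-monoʳ-≤ (0≤d x) (U≤b x) ⟩
        b * d x            ≡⟨ ℚ.*-comm b (d x) ⟩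
        d x * b            ∎

-- Hitting-time bounds independent of the horizon.

module HittingTimes {n} (G : Graph n) (degree>0 : ∀ x → 0 ℕ.< degree G x) where
  open Graph G
  open RandomWalk G degree>0

  -- The length is quantified before `f`: it depends on the path alone and hence serves `U k` for
  -- every `k`.
  path-bound : ∀ {x y} → Star _~_ x y → ∃[ ℓ ] ∀ (f : Fin n → ℚ) {η} →
               (∀ {u v} → u ~ v → f u - f v ℚ.≤ η) → f x - f y ℚ.≤ ι ℓ * η
  path-bound {x} ε = 0 , λ f {η} _ → ℚ.≤-reflexive (trans (ℚ.+-inverseʳ (f x)) (sym (ℚ.*-zeroˡ η)))
  path-bound {x} {y} (_◅_ {j = z} x~z p) with path-bound p
  ... | ℓ , bound = suc ℓ , λ f {η} step → begin
      f x - f y                  ≡⟨ split (f x) (f z) (f y) ⟩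
      (f x - f z) + (f z - f y)  ≤⟨ ℚ.+-mono-≤ (step x~z) (bound f step) ⟩
      η + ι ℓ * η                ≡⟨ distrib (ι ℓ) η ⟩
      (1ℚ + ι ℓ) * η             ≡⟨ cong (_* η) (ι-suc ℓ) ⟨
      ι (suc ℓ) * η              ∎
    where
    open ℚ.≤-Reasoning
    split : ∀ a b c → a - c ≡ (a - b) + (b - c)
    split = solve-∀ ringℚ
    distrib : ∀ a η → η + a * η ≡ (1ℚ + a) * η
    distrib = solve-∀ ringℚ

  vol>0 : Fin n → 0ℚ ℚ.< vol
  vol>0 x = ℚ.<-≤-trans (d>0 x) (term≤sum 0≤d x)

  -- The largest expected hitting time b satisfies b² ≤ ℓ² 𝓔(U , U) ≤ 2 ℓ² vol b
  -- for a bound ℓ on the distances, so it is bounded independently of the horizon k.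
  module _ (t : Fin n) where
    open Hitting t

    -- A crude common bound for the lengths of the chosen paths to `t`; the summand `1ℚ` makes it
    -- positive.
    ℓ : ℚ
    ℓ = 1ℚ + sum (λ x → ι (proj₁ (path-bound (connected x t))))

    ℓ>0 : 0ℚ ℚ.< ℓ
    ℓ>0 = ℚ.<-≤-trans (0<ι-suc 0) (≤-from-gap (sum-nonNeg (λ x → 0≤ι (proj₁ (path-bound (connected x t))))) refl)

    U-bounded : ∀ k x → U k x ℚ.≤ 2ℚ * (vol * ℓ * ℓ)
    U-bounded k x = ℚ.≤-trans (b-max x) b-bound
      where
      open ℚ.≤-Reasoning
      x* = proj₁ (argmax t (U k))
      b = U k x*
      b-max = proj₂ (argmax t (U k))
      -- An edge increment of `U k` is at most √(2 vol b), and `η` is the AM-GM bound for this root.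
      -- The weight is chosen so that `ℓ * η` contains exactly `½ * b`, which is then absorbed on
      -- the left.
      μ = 2ℚ * (vol * ℓ)
      μ>0 : 0ℚ ℚ.< μ
      μ>0 = *-pos {2ℚ} (0<ι-suc 1) (*-pos (vol>0 t) ℓ>0)
      l = proj₁ (inverse μ>0)
      l>0 = proj₁ (proj₂ (inverse μ>0))
      lμ≡1 : l * μ ≡ 1ℚ
      lμ≡1 = proj₂ (proj₂ (inverse μ>0))
      0≤b = U-nonNeg k x*
      η = l * (vol * b) + ½ * μ
      0≤η : 0ℚ ℚ.≤ η
      0≤η = +-nonNeg (*-nonNeg (ℚ.<⇒≤ l>0) (*-nonNeg (ℚ.<⇒≤ (vol>0 t)) 0≤b))
                     (*-nonNeg {½} (ℚ.nonNegative⁻¹ ½) (ℚ.<⇒≤ μ>0))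
      edge : ∀ {u v} → u ~ v → U k u - U k v ℚ.≤ η
      edge {u} {v} u~v = begin
        Δ                                     ≡⟨ halve Δ ⟩
        ½ * (2ℚ * (Δ * 1ℚ))                   ≤⟨ *-monoˡ-≤ {½} (ℚ.nonNegative⁻¹ ½) (am-gm Δ 1ℚ (ℚ.<⇒≤ l>0) lμ≡1) ⟩
        ½ * (l * (Δ * Δ) + μ * (1ℚ * 1ℚ))     ≤⟨ *-monoˡ-≤ {½} (ℚ.nonNegative⁻¹ ½) (ℚ.+-monoˡ-≤ (μ * (1ℚ * 1ℚ)) (*-monoˡ-≤ (ℚ.<⇒≤ l>0) Δ²≤)) ⟩
        ½ * (l * (2ℚ * (vol * b)) + μ * (1ℚ * 1ℚ))  ≡⟨ simplify l (vol * b) μ ⟩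
        η ∎
        where
        Δ = U k u - U k v
        Δ²≤ : Δ * Δ ℚ.≤ 2ℚ * (vol * b)
        Δ²≤ = ℚ.≤-trans (subst (ℚ._≤ 𝓔 (U k) (U k)) one (edge≤𝓔 (U k) u v)) (𝓔UU≤ k b-max)
          where
          one : adj u v * (Δ * Δ) ≡ Δ * Δ
          one rewrite dec-true (u ~? v) u~v = ℚ.*-identityˡ (Δ * Δ)
        halve : ∀ a → a ≡ ½ * (2ℚ * (a * 1ℚ))
        halve = solve-∀ ringℚ
        simplify : ∀ l a μ → ½ * (l * (2ℚ * a) + μ * (1ℚ * 1ℚ)) ≡ l * a + ½ * μ
        simplify = solve-∀ ringℚ
      ℓₓ = ι (proj₁ (path-bound (connected x* t)))
      ℓₓ≤ℓ : ℓₓ ℚ.≤ ℓ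
      ℓₓ≤ℓ = ℚ.≤-trans (term≤sum (λ x → 0≤ι (proj₁ (path-bound (connected x t)))) x*)
        (≤-from-gap {r = 1ℚ} (0≤ι 1) (ℚ.+-comm (sum (λ x → ι (proj₁ (path-bound (connected x t))))) 1ℚ))
      b≤ : b ℚ.≤ ½ * b + ½ * (μ * ℓ)
      b≤ = begin
        b                         ≡⟨ ℚ.+-identityʳ b ⟨
        b + 0ℚ                    ≡⟨ cong (λ z → b - z) (U-target k) ⟨
        b - U k t                 ≤⟨ proj₂ (path-bound (connected x* t)) (U k) edge ⟩
        ℓₓ * η                    ≤⟨ *-monoʳ-≤ 0≤η ℓₓ≤ℓ ⟩
        ℓ * η                     ≡⟨ expand l vol ℓ b ⟩
        ½ * (l * μ) * b + ½ * (μ * ℓ)  ≡⟨ cong (λ z → ½ * z * b + ½ * (μ * ℓ)) lμ≡1 ⟩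
        ½ * 1ℚ * b + ½ * (μ * ℓ)  ≡⟨ cong (λ z → z * b + ½ * (μ * ℓ)) (ℚ.*-identityʳ ½) ⟩
        ½ * b + ½ * (μ * ℓ)       ∎
        where
        expand : ∀ l v ℓ b → ℓ * (l * (v * b) + ½ * (2ℚ * (v * ℓ))) ≡
                             ½ * (l * (2ℚ * (v * ℓ))) * b + ½ * ((2ℚ * (v * ℓ)) * ℓ)
        expand = solve-∀ ringℚ
      b-bound : b ℚ.≤ 2ℚ * (vol * ℓ * ℓ)
      b-bound = ≤-from-gap (*-nonNeg {2ℚ} (0≤ι 2) (p≤q⇒0≤q-p b≤)) (collect b vol ℓ)
        where
        collect : ∀ b v ℓ → b + 2ℚ * (½ * b + ½ * (2ℚ * (v * ℓ) * ℓ) - b) ≡ 2ℚ * (v * ℓ * ℓ)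
        collect = solve-∀ ringℚ

    -- Markov's inequality with a horizon beyond twice the bound `U-bounded`, which does not depend
    -- on the horizon.
    survival≤½ : ∃[ N ] ∀ x → 2ℚ * V (suc N) x ℚ.≤ 1ℚ
    survival≤½ with archimedean (2ℚ * (2ℚ * (vol * ℓ * ℓ)))
    ... | N , B≤N = N , λ x → *-cancelˡ-≤ (0<ι-suc N) (begin
        ι (suc N) * (2ℚ * V (suc N) x)   ≡⟨ swap (ι (suc N)) (V (suc N) x) ⟩
        2ℚ * (ι (suc N) * V (suc N) x)   ≤⟨ *-monoˡ-≤ {2ℚ} (0≤ι 2) (k*V≤U (suc N) x) ⟩
        2ℚ * U (suc N) x                 ≤⟨ *-monoˡ-≤ {2ℚ} (0≤ι 2) (U-bounded (suc N) x) ⟩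
        2ℚ * (2ℚ * (vol * ℓ * ℓ))        ≤⟨ B≤N ⟩
        ι N                              ≤⟨ ι-mono-≤ (ℕ.n≤1+n N) ⟩
        ι (suc N)                        ≡⟨ ℚ.*-identityʳ (ι (suc N)) ⟨
        ι (suc N) * 1ℚ                   ∎)
      where
      open ℚ.≤-Reasoning
      swap : ∀ a b → a * (2ℚ * b) ≡ 2ℚ * (a * b)
      swap = solve-∀ ringℚ

    module _ {k} (V≤½ : ∀ x → 2ℚ * V k x ℚ.≤ 1ℚ) where
      u : Fin n → ℚ
      u = U k

      d≤2Lu : ∀ x → x ≢ t → d x ℚ.≤ 2ℚ * L u x
      d≤2Lu x x≢t = subst (λ z → d x ℚ.≤ 2ℚ * z) (sym (LU k x x≢t))
        (≤-from-gap (*-nonNeg (0≤d x) (p≤q⇒0≤q-p (V≤½ x))) (collect (d x) (V k x)))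
        where
        collect : ∀ d v → d + d * (1ℚ - 2ℚ * v) ≡ 2ℚ * (d * (1ℚ - v))
        collect = solve-∀ ringℚ

      -- The Laplacian of u is comparable to the degree off t, so ∑ d (h - h t) is
      -- controlled by 𝓔 u h, which is in turn bounded by the energies of u and h.
      average-excess : ∀ {M l μ} (h : Fin n → ℚ) → (∀ x → u x ℚ.≤ M) → (∀ x → h t ℚ.≤ h x) →
        0ℚ ℚ.≤ l → l * μ ≡ 1ℚ →
        sum (λ x → d x * (h x - h t)) ℚ.≤ l * (vol * M) + ½ * (μ * 𝓔 h h)
      average-excess {M} {l} {μ} h u≤M h-min 0≤l lμ≡1 = begin
        sum (λ x → d x * (h x - h t))                ≤⟨ sum-mono termwise ⟩
        sum (λ x → 2ℚ * (g x * L u x))               ≡⟨ *-distribˡ-sum 2ℚ (λ x → g x * L u x) ⟨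
        2ℚ * sum (λ x → g x * L u x)                 ≡⟨ 𝓔-L u g ⟨
        𝓔 u g                                        ≡⟨ halve (𝓔 u g) ⟩
        ½ * (2ℚ * 𝓔 u g)                             ≤⟨ *-monoˡ-≤ {½} (ℚ.nonNegative⁻¹ ½) (𝓔-am-gm u g 0≤l lμ≡1) ⟩
        ½ * (l * 𝓔 u u + μ * 𝓔 g g)                  ≤⟨ *-monoˡ-≤ {½} (ℚ.nonNegative⁻¹ ½) (ℚ.+-monoˡ-≤ (μ * 𝓔 g g) (*-monoˡ-≤ 0≤l (𝓔UU≤ k u≤M))) ⟩
        ½ * (l * (2ℚ * (vol * M)) + μ * 𝓔 g g)       ≡⟨ simplify l (vol * M) (μ * 𝓔 g g) ⟩
        l * (vol * M) + ½ * (μ * 𝓔 g g)              ≡⟨ cong (λ z → l * (vol * M) + ½ * (μ * z)) shift ⟩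
        l * (vol * M) + ½ * (μ * 𝓔 h h)              ∎
        where
        open ℚ.≤-Reasoning
        g : Fin n → ℚ
        g x = h x - h t
        halve : ∀ a → a ≡ ½ * (2ℚ * a)
        halve = solve-∀ ringℚ
        simplify : ∀ l a b → ½ * (l * (2ℚ * a) + b) ≡ l * a + ½ * b
        simplify = solve-∀ ringℚ
        shift : 𝓔 g g ≡ 𝓔 h h
        shift = sum-cong-≗ λ x → sum-cong-≗ λ y → cong (λ z → adj x y * (z * z)) (cancel (h x) (h y) (h t))
          where
          cancel : ∀ a b c → (a - c) - (b - c) ≡ a - b
          cancel = solve-∀ ringℚ
        termwise : ∀ x → d x * g x ℚ.≤ 2ℚ * (g x * L u x)
        termwise x = by-cases (x Fin.≟ t)
          where
          zeros : ∀ a b → a * 0ℚ ≡ 2ℚ * (0ℚ * b)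
          zeros = solve-∀ ringℚ
          swap : ∀ a b → a * (2ℚ * b) ≡ 2ℚ * (a * b)
          swap = solve-∀ ringℚ
          by-cases : Dec (x ≡ t) → d x * g x ℚ.≤ 2ℚ * (g x * L u x)
          by-cases (yes x≡t) = ℚ.≤-reflexive (trans (cong (d x *_) g≡0)
            (trans (zeros (d x) (L u x)) (cong (λ z → 2ℚ * (z * L u x)) (sym g≡0))))
            where
            g≡0 : g x ≡ 0ℚ
            g≡0 = trans (cong (λ y → h y - h t) x≡t) (ℚ.+-inverseʳ (h t))
          by-cases (no x≢t) = subst₂ ℚ._≤_ (ℚ.*-comm (g x) (d x)) (swap (g x) (L u x))
            (*-monoˡ-≤ (p≤q⇒0≤q-p (h-min x)) (d≤2Lu x x≢t))

      -- The Laplacian of `u` sums to zero. Off `t` it is at least half the degree, so this mass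
      -- must be balanced at `t`, where it is at least `- (d t * M)`. This is a truncated form of
      -- the fact that the expected return time to `t` is `vol` divided by `d t`.
      vol≤ : ∀ {M} → (∀ x → u x ℚ.≤ M) → vol ℚ.≤ d t + 2ℚ * (d t * M)
      vol≤ {M} u≤M = begin
        sum d                                                ≤⟨ sum-mono termwise ⟩
        sum (λ x → 2ℚ * L u x + 𝟙 (x Fin.≟ t) * c)            ≡⟨ ∑-distrib-+ (λ x → 2ℚ * L u x) (λ x → 𝟙 (x Fin.≟ t) * c) ⟩
        sum (λ x → 2ℚ * L u x) + sum (λ x → 𝟙 (x Fin.≟ t) * c) ≡⟨ cong₂ _+_ (sym (*-distribˡ-sum 2ℚ (L u))) (sum-single t c) ⟩
        2ℚ * sum (L u) + c                                   ≡⟨ cong (λ z → 2ℚ * z + c) (∑L≡0 u) ⟩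
        2ℚ * 0ℚ + c                                          ≡⟨ ℚ.+-identityˡ c ⟩
        c                                                    ∎
        where
        open ℚ.≤-Reasoning
        c = d t + 2ℚ * (d t * M)
        Lut : - (d t * M) ℚ.≤ L u t
        Lut = begin
          - (d t * M)                            ≡⟨ cong (λ z → - (z * M)) (d≡∑adj t) ⟩
          - (sum (adj t) * M)                    ≡⟨ cong -_ (*-distribʳ-sum M (adj t)) ⟩
          - sum (λ y → adj t y * M)              ≡⟨ sum-neg (λ y → adj t y * M) ⟨
          sum (λ y → - (adj t y * M))            ≤⟨ sum-mono (λ y → ≤-from-gap (*-nonNeg (0≤adj t y) (p≤q⇒0≤q-p (u≤M y))) (eq y)) ⟩
          L u t                                  ∎
          where
          regroup : ∀ a m b → - (a * m) + a * (m - b) ≡ a * (0ℚ - b)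
          regroup = solve-∀ ringℚ
          eq : ∀ y → - (adj t y * M) + adj t y * (M - u y) ≡ adj t y * (u t - u y)
          eq y = trans (regroup (adj t y) M (u y)) (cong (λ z → adj t y * (z - u y)) (sym (U-target k)))
        termwise : ∀ x → d x ℚ.≤ 2ℚ * L u x + 𝟙 (x Fin.≟ t) * c
        termwise x = by-cases (x Fin.≟ t)
          where
          at-target : ∀ d m l → d + 2ℚ * (l - - (d * m)) ≡ 2ℚ * l + 1ℚ * (d + 2ℚ * (d * m))
          at-target = solve-∀ ringℚ
          off-target : ∀ l c → 2ℚ * l ≡ 2ℚ * l + 0ℚ * c
          off-target = solve-∀ ringℚ
          by-cases : (x≟t : Dec (x ≡ t)) → d x ℚ.≤ 2ℚ * L u x + 𝟙 x≟t * c
          by-cases (yes refl) = ≤-from-gap (*-nonNeg {2ℚ} (0≤ι 2) (p≤q⇒0≤q-p Lut)) (at-target (d x) M (L u x))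
          by-cases (no x≢t)   = ℚ.≤-trans (d≤2Lu x x≢t) (ℚ.≤-reflexive (off-target (L u x) c))

-- The push process

E-nonNeg : {d : Dist A} → IsProbability d → {f : A → ℚ} → (∀ a → 0ℚ ℚ.≤ f a) → 0ℚ ℚ.≤ E d f
E-nonNeg {d = d} dp {f} 0≤f = subst (ℚ._≤ E d f) (E-const dp 0ℚ) (monotone dp 0≤f)

independently-isProbability : {B : Set} (f : B → Dist A) → (∀ b → IsProbability (f b)) →
                              ∀ bs → IsProbability (independently (List.map f bs))
independently-isProbability f fp []       = return-isProbability []
independently-isProbability f fp (b ∷ bs) =
  >>=-isProbability (fp b) λ a → mapᴰ-isProbability (a ∷_) (independently-isProbability f fp bs)

1-𝟙≥0 : {P : Set} (P? : Dec P) → 0ℚ ℚ.≤ 1ℚ - 𝟙 P?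
1-𝟙≥0 P? = p≤q⇒0≤q-p (𝟙≤1 P?)

-- The supermartingale potential: Φ D a bounds the expected future increase of
-- the sum of the squared delays of y behind its neighbours when the sum of these
-- delays is a; it is a discrete version of ∫ 2 b exp (- (b - a) / D) db over b ≥ a.
Φ : ℚ → ℚ → ℚ
Φ D a = ι 4 * (D * a) + ι 6 * (D * D)

-- Here `p` is the probability that `y` stays uninformed, and `2ℚ * a + k` bounds the growth of the
-- sum of squares. Multiplying by `D + k` allows `p` to be eliminated through `p * (D + k) ≤ D`,
-- which leaves a polynomial inequality.
Φ-step : ∀ {D p a k} → 1ℚ ℚ.≤ D → 0ℚ ℚ.≤ a → 1ℚ ℚ.≤ k → k ℚ.≤ D → p * (D + k) ℚ.≤ D →
         2ℚ * a + k + p * Φ D (a + k) ℚ.≤ Φ D a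
Φ-step {D} {p} {a} {k} 1≤D 0≤a 1≤k k≤D p≤ = *-cancelˡ-≤ 0<D+k (begin
  (D + k) * (2ℚ * a + k + p * Φ D (a + k))                ≡⟨ expand D k a p ⟩
  (D + k) * (2ℚ * a + k) + p * (D + k) * Φ D (a + k)      ≤⟨ ℚ.+-monoʳ-≤ ((D + k) * (2ℚ * a + k)) (*-monoʳ-≤ 0≤Φ p≤) ⟩
  (D + k) * (2ℚ * a + k) + D * Φ D (a + k)                ≤⟨ ≤-from-gap gap (collect D k a) ⟩
  (D + k) * Φ D a                                         ∎)
  where
  open ℚ.≤-Reasoning
  0<D : 0ℚ ℚ.< D
  0<D = ℚ.<-≤-trans (0<ι-suc 0) 1≤D
  0≤D = ℚ.<⇒≤ 0<D
  0≤k : 0ℚ ℚ.≤ k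
  0≤k = ℚ.≤-trans (0≤ι 1) 1≤k
  0<D+k : 0ℚ ℚ.< D + k
  0<D+k = ℚ.+-mono-<-≤ 0<D 0≤k
  0≤Φ : 0ℚ ℚ.≤ Φ D (a + k)
  0≤Φ = +-nonNeg (*-nonNeg (0≤ι 4) (*-nonNeg 0≤D (+-nonNeg 0≤a 0≤k))) (*-nonNeg (0≤ι 6) (*-nonNeg 0≤D 0≤D))
  expand : ∀ D k a p → (D + k) * (2ℚ * a + k + p * (ι 4 * (D * (a + k)) + ι 6 * (D * D))) ≡
           (D + k) * (2ℚ * a + k) + p * (D + k) * (ι 4 * (D * (a + k)) + ι 6 * (D * D))
  expand = solve-∀ ringℚ
  0≤k-1 = p≤q⇒0≤q-p 1≤k
  0≤D-1 = p≤q⇒0≤q-p 1≤D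
  0≤D-k = p≤q⇒0≤q-p k≤D
  -- The coefficient 4 of `Φ` leaves 4 D k a, which pays for 2 D a + 2 k a because `D` and `k` are
  -- at least 1. The coefficient 6, minus the 4 lost to the shift of `a`, leaves 2 D² k, which pays
  -- for D k + k².
  gap : 0ℚ ℚ.≤ 2ℚ * (D * a) * (k - 1ℚ) + 2ℚ * (a * k) * (D - 1ℚ) +
        (k * D * (D - 1ℚ) + (k * D * (D - 1ℚ) + k * (D - k)))
  gap = +-nonNeg (+-nonNeg (*-nonNeg (*-nonNeg (0≤ι 2) (*-nonNeg 0≤D 0≤a)) 0≤k-1)
                           (*-nonNeg (*-nonNeg (0≤ι 2) (*-nonNeg 0≤a 0≤k)) 0≤D-1))
                 (+-nonNeg (*-nonNeg (*-nonNeg 0≤k 0≤D) 0≤D-1)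
                           (+-nonNeg (*-nonNeg (*-nonNeg 0≤k 0≤D) 0≤D-1) (*-nonNeg 0≤k 0≤D-k)))
  collect : ∀ D k a → (D + k) * (2ℚ * a + k) + D * (ι 4 * (D * (a + k)) + ι 6 * (D * D)) +
            (2ℚ * (D * a) * (k - 1ℚ) + 2ℚ * (a * k) * (D - 1ℚ) +
            (k * D * (D - 1ℚ) + (k * D * (D - 1ℚ) + k * (D - k)))) ≡
            (D + k) * (ι 4 * (D * a) + ι 6 * (D * D))
  collect = solve-∀ ringℚ

module PushProcess {n} (G : Graph n) (degree>0 : ∀ x → 0 ℕ.< degree G x) {D : ℚ}
                   (d≤D : ∀ x → ι (degree G x) ℚ.≤ D) where
  open RandomWalk G degree>0

  -- `pushStep G I` unfolds to `mapᴰ (after I) (choices I)`. Since `I ⊆ after I ch` for every list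
  -- `ch`, growth of the informed set is available inside expectations over `choices I`.
  choices : Subset n → Dist (List (Fin n))
  choices I = independently (List.map (uniform ∘ neighbours G) (filter (_∈? I) (allFin n)))

  after : Subset n → List (Fin n) → Subset n
  after I chosen = I ∪ ⋃ (List.map ⁅_⁆ chosen)

  choices-isProbability : ∀ I → IsProbability (choices I)
  choices-isProbability I =
    independently-isProbability (uniform ∘ neighbours G) walkStep-isProbability (filter (_∈? I) (allFin n))

  pushStep-isProbability : ∀ I → IsProbability (pushStep G I)
  pushStep-isProbability I = mapᴰ-isProbability (after I) (choices-isProbability I)

  E-push : ∀ N I f → E (trajectory (pushStep G) (suc N) I) f ≡
           E (choices I) (λ ch → E (trajectory (pushStep G) N (after I ch)) (λ ω → f (I Vec.∷ ω)))
  E-push N I f = trans (E-trajectory (pushStep G) N I f) (E-mapᴰ (after I) (choices I) _)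

  module _ (y : Fin n) where

    -- The indicator that no push hits `y`, written as a product so that its expectation factorises
    -- over the independent choices.
    missed : List (Fin n) → ℚ
    missed []       = 1ℚ
    missed (z ∷ zs) = (1ℚ - 𝟙 (z Fin.≟ y)) * missed zs

    missed-nonNeg : ∀ zs → 0ℚ ℚ.≤ missed zs
    missed-nonNeg []       = 0≤ι 1
    missed-nonNeg (z ∷ zs) = *-nonNeg (1-𝟙≥0 (z Fin.≟ y)) (missed-nonNeg zs)

    uninformed≤missed : ∀ I zs → 1ℚ - 𝟙 (y ∈? after I zs) ℚ.≤ missed zs
    uninformed≤missed I zs with y ∈? after I zs
    ... | yes _ = missed-nonNeg zs
    ... | no y∉ = ℚ.≤-reflexive (sym (all-missed zs (y∉ ∘ q⊆p∪q I (⋃ (List.map ⁅_⁆ zs)))))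
      where
      all-missed : ∀ zs → y ∉ ⋃ (List.map ⁅_⁆ zs) → missed zs ≡ 1ℚ
      all-missed []       _  = refl
      all-missed (z ∷ zs) y∉ with z Fin.≟ y
      ... | yes refl = contradiction (p⊆p∪q (⋃ (List.map ⁅_⁆ zs)) (x∈⁅x⁆ y)) y∉
      ... | no _     = trans (ℚ.*-identityˡ (missed zs)) (all-missed zs (y∉ ∘ q⊆p∪q ⁅ z ⁆ (⋃ (List.map ⁅_⁆ zs))))

    d*avoid : ∀ x → d x * P (λ z → 1ℚ - 𝟙 (z Fin.≟ y)) x ≡ d x - adj x y
    d*avoid x = begin
      d x * P (λ z → 1ℚ - 𝟙 (z Fin.≟ y)) x                 ≡⟨ d*P (λ z → 1ℚ - 𝟙 (z Fin.≟ y)) x ⟩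
      sum (λ z → adj x z * (1ℚ - 𝟙 (z Fin.≟ y)))           ≡⟨ sum-cong-≗ (λ z → expand z (z Fin.≟ y)) ⟩
      sum (λ z → adj x z - 𝟙 (z Fin.≟ y) * adj x y)        ≡⟨ sum-minus (adj x) (λ z → 𝟙 (z Fin.≟ y) * adj x y) ⟩
      sum (adj x) - sum (λ z → 𝟙 (z Fin.≟ y) * adj x y)    ≡⟨ cong₂ _-_ (sym (d≡∑adj x)) (sum-single y (adj x y)) ⟩
      d x - adj x y                                        ∎
      where
      open ≡-Reasoning
      hit : ∀ a → a * (1ℚ - 1ℚ) ≡ a - 1ℚ * a
      hit = solve-∀ ringℚ
      miss : ∀ a b → a * (1ℚ - 0ℚ) ≡ a - 0ℚ * b
      miss = solve-∀ ringℚ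
      expand : ∀ z (z≟y : Dec (z ≡ y)) → adj x z * (1ℚ - 𝟙 z≟y) ≡ adj x z - 𝟙 z≟y * adj x y
      expand z (yes refl) = hit (adj x z)
      expand z (no _)     = miss (adj x z) (adj x y)

    -- The avoidance probability is a product of factors `1 - adj x y / d x`. Each factor is at most
    -- `(D + k) / (D + adj x y + k)` because `d x ≤ D`, so the product telescopes.
    E-missed≤ : ∀ xs → E (independently (List.map (uniform ∘ neighbours G) xs)) missed *
                       (D + sumᴸ (λ x → adj x y) xs) ℚ.≤ D
    E-missed≤ [] = ℚ.≤-reflexive (trans (cong (_* (D + 0ℚ)) (E-return [] missed)) (unit D))
      where
      unit : ∀ D → 1ℚ * (D + 0ℚ) ≡ D
      unit = solve-∀ ringℚ
    E-missed≤ (x ∷ xs) = begin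
      E (ind (x ∷ xs)) missed * (D + (a + k))  ≡⟨ cong (_* (D + (a + k))) factor ⟩
      e * R * (D + (a + k))                    ≡⟨ swap e R (D + (a + k)) ⟩
      R * (e * (D + (a + k)))                  ≤⟨ *-monoˡ-≤ 0≤R (*-cancelˡ-≤ (d>0 x) one-vertex) ⟩
      R * (D + k)                              ≤⟨ E-missed≤ xs ⟩
      D                                        ∎
      where
      open ℚ.≤-Reasoning
      ind : List (Fin n) → Dist (List (Fin n))
      ind = independently ∘ List.map (uniform ∘ neighbours G)
      a = adj x y
      k = sumᴸ (λ x → adj x y) xs
      e = P (λ z → 1ℚ - 𝟙 (z Fin.≟ y)) x
      R = E (ind xs) missed
      0≤R : 0ℚ ℚ.≤ R
      0≤R = E-nonNeg (independently-isProbability (uniform ∘ neighbours G) walkStep-isProbability xs) missed-nonNeg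
      0≤k : ∀ xs → 0ℚ ℚ.≤ sumᴸ (λ x → adj x y) xs
      0≤k []       = ℚ.≤-refl
      0≤k (x ∷ xs) = +-nonNeg (0≤adj x y) (0≤k xs)
      swap : ∀ e r c → e * r * c ≡ r * (e * c)
      swap = solve-∀ ringℚ
      factor : E (ind (x ∷ xs)) missed ≡ e * R
      factor = trans (E->>= (walkStep G x) (λ z → mapᴰ (z ∷_) (ind xs)) missed)
        (trans (E-cong (walkStep G x) (λ z → trans (E-mapᴰ (z ∷_) (ind xs) missed)
                 (trans (E-*ˡ (ind xs) (1ℚ - 𝟙 (z Fin.≟ y)) missed) (ℚ.*-comm (1ℚ - 𝟙 (z Fin.≟ y)) R))))
        (trans (E-*ˡ (walkStep G x) R (λ z → 1ℚ - 𝟙 (z Fin.≟ y))) (ℚ.*-comm R e)))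
      one-vertex : d x * (e * (D + (a + k))) ℚ.≤ d x * (D + k)
      one-vertex = begin
        d x * (e * (D + (a + k)))   ≡⟨ ℚ.*-assoc (d x) e (D + (a + k)) ⟨
        d x * e * (D + (a + k))     ≡⟨ cong (_* (D + (a + k))) (d*avoid x) ⟩
        (d x - a) * (D + (a + k))   ≤⟨ ≤-from-gap (*-nonNeg (0≤adj x y) (+-nonNeg (+-nonNeg (p≤q⇒0≤q-p (d≤D x)) (0≤k xs)) (0≤adj x y)))
                                          (collect (d x) a D k) ⟩
        d x * (D + k)               ∎
        where
        collect : ∀ d a D k → (d - a) * (D + (a + k)) + a * (D - d + k + a) ≡ d * (D + k)
        collect = solve-∀ ringℚ

    uninformedProb : Subset n → ℚ
    uninformedProb I = E (choices I) (λ ch → 1ℚ - 𝟙 (y ∈? after I ch))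

    informedNeighbours : Subset n → ℚ
    informedNeighbours I = sum λ x → 𝟙 (x ∈? I) * adj x y

    uninformedProb≤ : ∀ I → uninformedProb I * (D + informedNeighbours I) ℚ.≤ D
    uninformedProb≤ I = begin
      uninformedProb I * (D + informedNeighbours I)
        ≤⟨ *-monoʳ-≤ (+-nonNeg 0≤D (sum-nonNeg λ x → *-nonNeg (0≤𝟙 (x ∈? I)) (0≤adj x y)))
             (monotone (choices-isProbability I) (uninformed≤missed I)) ⟩
      E (choices I) missed * (D + informedNeighbours I)
        ≡⟨ cong (λ z → E (choices I) missed * (D + z)) (sumᴸ-filter-allFin (_∈? I) (λ x → adj x y)) ⟨
      E (choices I) missed * (D + sumᴸ (λ x → adj x y) (filter (_∈? I) (allFin n)))
        ≤⟨ E-missed≤ (filter (_∈? I) (allFin n)) ⟩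
      D ∎
      where
      open ℚ.≤-Reasoning
      0≤D : 0ℚ ℚ.≤ D
      0≤D = ℚ.≤-trans (0≤d y) (d≤D y)

-- Second moments of the delays behind neighbours.

module Delays {n} (G : Graph n) (degree>0 : ∀ x → 0 ℕ.< degree G x) {D : ℚ}
              (d≤D : ∀ x → ι (degree G x) ℚ.≤ D) (1≤D : 1ℚ ℚ.≤ D) where
  open Graph G
  open RandomWalk G degree>0
  open PushProcess G degree>0 d≤D

  -- Along increasing informed sets this is the positive part of τ y - τ x, cut off at the end of
  -- the path; as a count it can be peeled off state by state.
  delay : ∀ {N} → Fin n → Fin n → Vec (Subset n) N → ℚ
  delay x y Vec.[]      = 0ℚ
  delay x y (I Vec.∷ ω) = 𝟙 (x ∈? I) * (1ℚ - 𝟙 (y ∈? I)) + delay x y ω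

  delay-nonNeg : ∀ {N} x y (ω : Vec (Subset n) N) → 0ℚ ℚ.≤ delay x y ω
  delay-nonNeg x y Vec.[]      = ℚ.≤-refl
  delay-nonNeg x y (I Vec.∷ ω) = +-nonNeg (*-nonNeg (0≤𝟙 (x ∈? I)) (1-𝟙≥0 (y ∈? I))) (delay-nonNeg x y ω)

  module _ (y : Fin n) where

    -- `a` holds the delays incurred before `ω` starts, which lets an induction consume the first
    -- state.
    squares : ∀ {N} → (Fin n → ℚ) → Vec (Subset n) N → ℚ
    squares a ω = sum λ x → adj x y * ((a x + delay x y ω) * (a x + delay x y ω))

    S₂ S₁ : (Fin n → ℚ) → ℚ
    S₂ a = sum λ x → adj x y * (a x * a x)
    S₁ a = sum λ x → adj x y * a x

    advance : Subset n → (Fin n → ℚ) → Fin n → ℚ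
    advance I a x = a x + 𝟙 (x ∈? I) * (1ℚ - 𝟙 (y ∈? I))

    squares-∷ : ∀ {N} a I (ω : Vec (Subset n) N) → squares a (I Vec.∷ ω) ≡ squares (advance I a) ω
    squares-∷ a I ω = sum-cong-≗ λ x → cong (λ z → adj x y * (z * z))
      (sym (ℚ.+-assoc (a x) (𝟙 (x ∈? I) * (1ℚ - 𝟙 (y ∈? I))) (delay x y ω)))

    squares-[] : ∀ a → squares a Vec.[] ≡ S₂ a
    squares-[] a = sum-cong-≗ λ x → cong (λ z → adj x y * (z * z)) (ℚ.+-identityʳ (a x))

    E-squares-zero : ∀ I a → E (trajectory (pushStep G) 0 I) (squares a) ≡ S₂ (advance I a)
    E-squares-zero I a = trans (E-return (I Vec.∷ Vec.[]) (squares a))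
      (trans (squares-∷ a I Vec.[]) (squares-[] (advance I a)))

    E-squares-suc : ∀ N I a → E (trajectory (pushStep G) (suc N) I) (squares a) ≡
      E (choices I) (λ ch → E (trajectory (pushStep G) N (after I ch)) (squares (advance I a)))
    E-squares-suc N I a = trans (E-push N I (squares a))
      (E-cong (choices I) λ ch → E-cong (trajectory (pushStep G) N (after I ch)) (squares-∷ a I))

    S₂-cong : ∀ {a b} → (∀ x → a x ≡ b x) → S₂ a ≡ S₂ b
    S₂-cong a≗b = sum-cong-≗ λ x → cong (λ z → adj x y * (z * z)) (a≗b x)

    advance-informed : ∀ {I} → y ∈ I → ∀ a x → advance I a x ≡ a x
    advance-informed {I} y∈I a x rewrite dec-true (y ∈? I) y∈I =
      trans (cong (a x +_) (ℚ.*-zeroʳ (𝟙 (x ∈? I)))) (ℚ.+-identityʳ (a x))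

    advance-uninformed : ∀ {I} → y ∉ I → ∀ a x → advance I a x ≡ a x + 𝟙 (x ∈? I)
    advance-uninformed {I} y∉I a x rewrite dec-false (y ∈? I) y∉I = cong (a x +_) (ℚ.*-identityʳ (𝟙 (x ∈? I)))

    -- Informed sets only grow, so once `y` is informed its delays are frozen.
    E-squares-informed : ∀ N {I} → y ∈ I → ∀ a → E (trajectory (pushStep G) N I) (squares a) ≡ S₂ a
    E-squares-informed zero    {I} y∈I a = trans (E-squares-zero I a) (S₂-cong (advance-informed y∈I a))
    E-squares-informed (suc N) {I} y∈I a = begin
      E (trajectory (pushStep G) (suc N) I) (squares a)  ≡⟨ E-squares-suc N I a ⟩
      E (choices I) (λ ch → E (trajectory (pushStep G) N (after I ch)) (squares (advance I a)))
        ≡⟨ E-cong (choices I) (λ ch → E-squares-informed N (p⊆p∪q (⋃ (List.map ⁅_⁆ ch)) y∈I) (advance I a)) ⟩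
      E (choices I) (λ _ → S₂ (advance I a))              ≡⟨ E-const (choices-isProbability I) (S₂ (advance I a)) ⟩
      S₂ (advance I a)                                    ≡⟨ S₂-cong (advance-informed y∈I a) ⟩
      S₂ a                                                ∎
      where open ≡-Reasoning

    module _ {I : Subset n} (y∉I : y ∉ I) {a : Fin n → ℚ} (0≤a : ∀ x → 0ℚ ℚ.≤ a x) where

      k = informedNeighbours y I

      -- Extending the increment `2ℚ * a x` from the informed to all neighbours makes the bound
      -- depend on `a` only through `S₁ a`.
      S₂-advance : S₂ (advance I a) ℚ.≤ S₂ a + (2ℚ * S₁ a + k)
      S₂-advance = begin
        S₂ (advance I a)    ≡⟨ S₂-cong (advance-uninformed y∉I a) ⟩
        S₂ (λ x → a x + 𝟙 (x ∈? I))
          ≤⟨ sum-mono (λ x → ≤-from-gap (gap x) (collect (adj x y) (a x) (𝟙 (x ∈? I)))) ⟩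
        sum (λ x → adj x y * (a x * a x) + (2ℚ * (adj x y * a x) + 𝟙 (x ∈? I) * adj x y))
          ≡⟨ ∑-distrib-+ (λ x → adj x y * (a x * a x)) (λ x → 2ℚ * (adj x y * a x) + 𝟙 (x ∈? I) * adj x y) ⟩
        S₂ a + sum (λ x → 2ℚ * (adj x y * a x) + 𝟙 (x ∈? I) * adj x y)
          ≡⟨ cong (S₂ a +_) (∑-distrib-+ (λ x → 2ℚ * (adj x y * a x)) (λ x → 𝟙 (x ∈? I) * adj x y)) ⟩
        S₂ a + (sum (λ x → 2ℚ * (adj x y * a x)) + k)
          ≡⟨ cong (λ z → S₂ a + (z + k)) (*-distribˡ-sum 2ℚ (λ x → adj x y * a x)) ⟨
        S₂ a + (2ℚ * S₁ a + k) ∎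
        where
        open ℚ.≤-Reasoning
        gap : ∀ x → 0ℚ ℚ.≤ adj x y * (2ℚ * a x * (1ℚ - 𝟙 (x ∈? I)) + 𝟙 (x ∈? I) * (1ℚ - 𝟙 (x ∈? I)))
        gap x = *-nonNeg (0≤adj x y) (+-nonNeg (*-nonNeg (*-nonNeg {2ℚ} (0≤ι 2) (0≤a x)) (1-𝟙≥0 (x ∈? I)))
                                              (*-nonNeg (0≤𝟙 (x ∈? I)) (1-𝟙≥0 (x ∈? I))))
        collect : ∀ w a i → w * ((a + i) * (a + i)) + w * (2ℚ * a * (1ℚ - i) + i * (1ℚ - i)) ≡
                            w * (a * a) + (2ℚ * (w * a) + i * w)
        collect = solve-∀ ringℚ

      S₁-advance : S₁ (advance I a) ≡ S₁ a + k
      S₁-advance = trans (sum-cong-≗ λ x → trans (cong (adj x y *_) (advance-uninformed y∉I a x))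
                                               (distrib (adj x y) (a x) (𝟙 (x ∈? I))))
                        (∑-distrib-+ (λ x → adj x y * a x) (λ x → 𝟙 (x ∈? I) * adj x y))
        where
        distrib : ∀ w a i → w * (a + i) ≡ w * a + i * w
        distrib = solve-∀ ringℚ

      k≤D : k ℚ.≤ D
      k≤D = begin
        k                       ≤⟨ sum-mono (λ x → ≤-from-gap (*-nonNeg (1-𝟙≥0 (x ∈? I)) (0≤adj x y)) (collect (𝟙 (x ∈? I)) (adj x y))) ⟩
        sum (λ x → adj x y)     ≡⟨ sum-cong-≗ (λ x → adj-sym x y) ⟩
        sum (adj y)             ≡⟨ d≡∑adj y ⟨
        d y                     ≤⟨ d≤D y ⟩
        D                       ∎
        where
        open ℚ.≤-Reasoning
        collect : ∀ i w → i * w + (1ℚ - i) * w ≡ w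
        collect = solve-∀ ringℚ

      S₁≥0 : 0ℚ ℚ.≤ S₁ a
      S₁≥0 = sum-nonNeg λ x → *-nonNeg (0≤adj x y) (0≤a x)

      -- `Φ-step` needs an informed neighbour. If there is none, the potential would not pay for a
      -- positive `S₁ a`; the support condition excludes this, since only informed vertices carry
      -- delay, and then `p ≤ 1ℚ` is enough.
      Φ-decrease : (∀ x → x ∉ I → a x ≡ 0ℚ) → ∀ {p} → 0ℚ ℚ.≤ p → p ℚ.≤ 1ℚ → p * (D + k) ℚ.≤ D →
                   2ℚ * S₁ a + k + p * Φ D (S₁ a + k) ℚ.≤ Φ D (S₁ a)
      Φ-decrease a-support {p} 0≤p p≤1 p≤ with Fin.any? (λ x → (x ∈? I) ×-dec (x ~? y))
      ... | yes (x , x∈I , x~y) = Φ-step {p = p} 1≤D S₁≥0 1≤k k≤D p≤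
        where
        one : 𝟙 (x ∈? I) * adj x y ≡ 1ℚ
        one rewrite dec-true (x ∈? I) x∈I | dec-true (x ~? y) x~y = refl
        1≤k : 1ℚ ℚ.≤ k
        1≤k = subst (ℚ._≤ k) one (term≤sum (λ x → *-nonNeg (0≤𝟙 (x ∈? I)) (0≤adj x y)) x)
      ... | no none = subst₂ (λ a k → 2ℚ * a + k + p * Φ D (a + k) ℚ.≤ Φ D a) (sym S₁≡0) (sym k≡0) at-zero
        where
        zero-sum : {f : Fin n → ℚ} → (∀ x → f x ≡ 0ℚ) → sum f ≡ 0ℚ
        zero-sum f≗0 = trans (sum-cong-≗ f≗0) (trans (sum-const n 0ℚ) (ℚ.*-zeroʳ (ι n)))
        S₁≡0 : S₁ a ≡ 0ℚ
        S₁≡0 = zero-sum vanish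
          where
          vanish : ∀ x → adj x y * a x ≡ 0ℚ
          vanish x with x ∈? I | x ~? y
          ... | yes x∈I | yes x~y = contradiction (x , x∈I , x~y) none
          ... | _       | no _    = ℚ.*-zeroˡ (a x)
          ... | no x∉I  | yes _   = trans (cong (1ℚ *_) (a-support x x∉I)) (ℚ.*-zeroʳ 1ℚ)
        k≡0 : k ≡ 0ℚ
        k≡0 = zero-sum vanish
          where
          vanish : ∀ x → 𝟙 (x ∈? I) * adj x y ≡ 0ℚ
          vanish x with x ∈? I | x ~? y
          ... | yes x∈I | yes x~y = contradiction (x , x∈I , x~y) none
          ... | yes _   | no _    = refl
          ... | no _    | yes _   = refl
          ... | no _    | no _    = refl
        0≤D : 0ℚ ℚ.≤ D
        0≤D = ℚ.≤-trans (0≤ι 1) 1≤D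
        at-zero : 2ℚ * 0ℚ + 0ℚ + p * Φ D (0ℚ + 0ℚ) ℚ.≤ Φ D 0ℚ
        at-zero = ≤-from-gap (*-nonNeg (p≤q⇒0≤q-p p≤1) (*-nonNeg (0≤ι 6) (*-nonNeg 0≤D 0≤D))) (collect p D)
          where
          collect : ∀ p D → 2ℚ * 0ℚ + 0ℚ + p * (ι 4 * (D * (0ℚ + 0ℚ)) + ι 6 * (D * D)) + (1ℚ - p) * (ι 6 * (D * D)) ≡
                            ι 4 * (D * 0ℚ) + ι 6 * (D * D)
          collect = solve-∀ ringℚ

    E-squares-uninformed : ∀ N {I} → y ∉ I → ∀ {a} → (∀ x → 0ℚ ℚ.≤ a x) → (∀ x → x ∉ I → a x ≡ 0ℚ) →
                           E (trajectory (pushStep G) N I) (squares a) ℚ.≤ S₂ a + Φ D (S₁ a)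
    E-squares-uninformed zero {I} y∉I {a} 0≤a a-support = begin
      E (trajectory (pushStep G) 0 I) (squares a)    ≡⟨ E-squares-zero I a ⟩
      S₂ (advance I a)                                ≤⟨ S₂-advance y∉I 0≤a ⟩
      -- At the last state no future remains, so the step inequality is used with survival
      -- probability zero.
      S₂ a + (2ℚ * S₁ a + k₀)                          ≡⟨ cong (S₂ a +_) (pad (2ℚ * S₁ a + k₀) (Φ D (S₁ a + k₀))) ⟩
      S₂ a + (2ℚ * S₁ a + k₀ + 0ℚ * Φ D (S₁ a + k₀))    ≤⟨ ℚ.+-monoʳ-≤ (S₂ a) (Φ-decrease y∉I 0≤a a-support ℚ.≤-refl (0≤ι 1) 0≤D) ⟩
      S₂ a + Φ D (S₁ a)                                ∎
      where
      open ℚ.≤-Reasoning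
      k₀ = informedNeighbours y I
      pad : ∀ a b → a ≡ a + 0ℚ * b
      pad = solve-∀ ringℚ
      0≤D : 0ℚ * (D + k₀) ℚ.≤ D
      0≤D = subst (ℚ._≤ D) (sym (ℚ.*-zeroˡ (D + k₀))) (ℚ.≤-trans (0≤ι 1) 1≤D)
    E-squares-uninformed (suc N) {I} y∉I {a} 0≤a a-support = begin
      E (trajectory (pushStep G) (suc N) I) (squares a)        ≡⟨ E-squares-suc N I a ⟩
      E (choices I) (λ ch → E (trajectory (pushStep G) N (after I ch)) (squares a⁺))
        ≤⟨ monotone (choices-isProbability I) (λ ch → next ch (y ∈? after I ch)) ⟩
      E (choices I) (λ ch → S₂ a⁺ + Φ D (S₁ a⁺) * (1ℚ - 𝟙 (y ∈? after I ch)))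
        ≡⟨ E-+ (choices I) (λ _ → S₂ a⁺) (λ ch → Φ D (S₁ a⁺) * (1ℚ - 𝟙 (y ∈? after I ch))) ⟩
      E (choices I) (λ _ → S₂ a⁺) + E (choices I) (λ ch → Φ D (S₁ a⁺) * (1ℚ - 𝟙 (y ∈? after I ch)))
        ≡⟨ cong₂ _+_ (E-const (choices-isProbability I) (S₂ a⁺)) (E-*ˡ (choices I) (Φ D (S₁ a⁺)) (λ ch → 1ℚ - 𝟙 (y ∈? after I ch))) ⟩
      S₂ a⁺ + Φ D (S₁ a⁺) * p                           ≡⟨ cong (λ z → S₂ a⁺ + Φ D z * p) (S₁-advance y∉I 0≤a) ⟩
      S₂ a⁺ + Φ D (S₁ a + k₀) * p                       ≤⟨ ℚ.+-monoˡ-≤ (Φ D (S₁ a + k₀) * p) (S₂-advance y∉I 0≤a) ⟩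
      S₂ a + (2ℚ * S₁ a + k₀) + Φ D (S₁ a + k₀) * p      ≡⟨ regroup (S₂ a) (2ℚ * S₁ a + k₀) (Φ D (S₁ a + k₀)) p ⟩
      S₂ a + (2ℚ * S₁ a + k₀ + p * Φ D (S₁ a + k₀))      ≤⟨ ℚ.+-monoʳ-≤ (S₂ a) (Φ-decrease y∉I 0≤a a-support 0≤p p≤1 (uninformedProb≤ y I)) ⟩
      S₂ a + Φ D (S₁ a)                                 ∎
      where
      open ℚ.≤-Reasoning
      k₀ = informedNeighbours y I
      p = uninformedProb y I
      a⁺ = advance I a
      regroup : ∀ q b c p → q + b + c * p ≡ q + (b + p * c)
      regroup = solve-∀ ringℚ
      0≤p : 0ℚ ℚ.≤ p
      0≤p = E-nonNeg (choices-isProbability I) (λ ch → 1-𝟙≥0 (y ∈? after I ch))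
      1-𝟙≤1 : {P : Set} (P? : Dec P) → 1ℚ - 𝟙 P? ℚ.≤ 1ℚ
      1-𝟙≤1 (yes _) = 0≤ι 1
      1-𝟙≤1 (no _)  = ℚ.≤-refl
      p≤1 : p ℚ.≤ 1ℚ
      p≤1 = subst (p ℚ.≤_) (total (choices-isProbability I)) (monotone (choices-isProbability I) (λ ch → 1-𝟙≤1 (y ∈? after I ch)))
      0≤a⁺ : ∀ x → 0ℚ ℚ.≤ a⁺ x
      0≤a⁺ x = +-nonNeg (0≤a x) (*-nonNeg (0≤𝟙 (x ∈? I)) (1-𝟙≥0 (y ∈? I)))
      a⁺-support : ∀ ch x → x ∉ after I ch → a⁺ x ≡ 0ℚ
      a⁺-support ch x x∉ = trans (advance-uninformed y∉I a x) (cong₂ _+_ (a-support x x∉I) 𝟙≡0)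
        where
        x∉I : x ∉ I
        x∉I = x∉ ∘ p⊆p∪q (⋃ (List.map ⁅_⁆ ch))
        𝟙≡0 : 𝟙 (x ∈? I) ≡ 0ℚ
        𝟙≡0 rewrite dec-false (x ∈? I) x∉I = refl
      next : ∀ ch (y∈? : Dec (y ∈ after I ch)) →
             E (trajectory (pushStep G) N (after I ch)) (squares a⁺) ℚ.≤ S₂ a⁺ + Φ D (S₁ a⁺) * (1ℚ - 𝟙 y∈?)
      next ch (yes y∈) = ℚ.≤-reflexive (trans (E-squares-informed N y∈ a⁺) (pad (S₂ a⁺) (Φ D (S₁ a⁺))))
        where
        pad : ∀ q f → q ≡ q + f * (1ℚ - 1ℚ)
        pad = solve-∀ ringℚ
      next ch (no y∉) = ℚ.≤-trans (E-squares-uninformed N y∉ 0≤a⁺ (a⁺-support ch))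
        (ℚ.≤-reflexive (cong (S₂ a⁺ +_) (sym (ℚ.*-identityʳ (Φ D (S₁ a⁺))))))

    -- No delay has been incurred at the start, so the bound is the potential `Φ D 0ℚ`.
    E-delay²≤ : ∀ N I → E (trajectory (pushStep G) N I) (λ ω → sum λ x → adj x y * (delay x y ω * delay x y ω)) ℚ.≤
                        ι 6 * (D * D)
    E-delay²≤ N I = begin
      E tr (λ ω → sum λ x → adj x y * (delay x y ω * delay x y ω))
        ≡⟨ E-cong tr (λ ω → sum-cong-≗ λ x → cong (λ z → adj x y * (z * z)) (ℚ.+-identityˡ (delay x y ω))) ⟨
      E tr (squares (λ _ → 0ℚ))  ≤⟨ by-cases (y ∈? I) ⟩
      ι 6 * (D * D)              ∎
      where
      open ℚ.≤-Reasoning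
      tr = trajectory (pushStep G) N I
      zero-sum : sum {n} (λ x → adj x y * 0ℚ) ≡ 0ℚ
      zero-sum = trans (sum-cong-≗ λ x → ℚ.*-zeroʳ (adj x y)) (trans (sum-const n 0ℚ) (ℚ.*-zeroʳ (ι n)))
      0≤D² : 0ℚ ℚ.≤ D * D
      0≤D² = 0≤p² D
      simplify : ∀ D → 0ℚ + (ι 4 * (D * 0ℚ) + ι 6 * (D * D)) ≡ ι 6 * (D * D)
      simplify = solve-∀ ringℚ
      by-cases : Dec (y ∈ I) → E tr (squares (λ _ → 0ℚ)) ℚ.≤ ι 6 * (D * D)
      by-cases (yes y∈I) = subst (ℚ._≤ ι 6 * (D * D))
        (sym (trans (E-squares-informed N y∈I (λ _ → 0ℚ)) zero-sum)) (*-nonNeg (0≤ι 6) 0≤D²)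
      by-cases (no y∉I)  = ℚ.≤-trans (E-squares-uninformed N y∉I (λ _ → ℚ.≤-refl) (λ _ _ → refl))
        (ℚ.≤-reflexive (trans (cong₂ (λ q a → q + Φ D a) zero-sum zero-sum) (simplify D)))

-- The minimal and the maximal vertex of h each contribute an average-excess
-- bound, and the two averages add up to the whole oscillation of h.
module Oscillation {n} (G : Graph n) (degree>0 : ∀ x → 0 ℕ.< degree G x) where
  open RandomWalk G degree>0
  open HittingTimes G degree>0
  open Hitting using (U)

  horizon : Fin n → ℕ
  horizon t = suc (proj₁ (survival≤½ t))

  oscillation : ∀ {M l μ} (h : Fin n → ℚ) {s v} →
    (∀ t x → U t (horizon t) x ℚ.≤ M) → (∀ x → h s ℚ.≤ h x) → (∀ x → h x ℚ.≤ h v) →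
    0ℚ ℚ.≤ l → l * μ ≡ 1ℚ → vol * (h v - h s) ℚ.≤ 2ℚ * (l * (vol * M)) + μ * 𝓔 h h
  oscillation {M} {l} {μ} h {s} {v} U≤M h-min h-max 0≤l lμ≡1 = begin
    vol * (h v - h s)                   ≡⟨ *-distribʳ-sum (h v - h s) d ⟩
    sum (λ x → d x * (h v - h s))       ≡⟨ sum-cong-≗ (λ x → split (d x) (h x) (h v) (h s)) ⟩
    sum (λ x → d x * (h x - h s) + d x * (- h x - - h v))
      ≡⟨ ∑-distrib-+ (λ x → d x * (h x - h s)) (λ x → d x * (- h x - - h v)) ⟩
    sum (λ x → d x * (h x - h s)) + sum (λ x → d x * (- h x - - h v))
      ≤⟨ ℚ.+-mono-≤
           (average-excess s {horizon s} (proj₂ (survival≤½ s)) h (U≤M s) h-min 0≤l lμ≡1)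
           (average-excess v {horizon v} (proj₂ (survival≤½ v)) (λ x → - h x) (U≤M v) (λ x → ℚ.neg-antimono-≤ (h-max x)) 0≤l lμ≡1) ⟩
    (l * (vol * M) + ½ * (μ * 𝓔 h h)) + (l * (vol * M) + ½ * (μ * 𝓔 (λ x → - h x) (λ x → - h x)))
      ≡⟨ cong (λ z → (l * (vol * M) + ½ * (μ * 𝓔 h h)) + (l * (vol * M) + ½ * (μ * z))) 𝓔-neg ⟩
    (l * (vol * M) + ½ * (μ * 𝓔 h h)) + (l * (vol * M) + ½ * (μ * 𝓔 h h))
      ≡⟨ collect (l * (vol * M)) (μ * 𝓔 h h) ⟩
    2ℚ * (l * (vol * M)) + μ * 𝓔 h h    ∎
    where
    open ℚ.≤-Reasoning
    split : ∀ d a b c → d * (b - c) ≡ d * (a - c) + d * (- a - - b)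
    split = solve-∀ ringℚ
    collect : ∀ a b → (a + ½ * b) + (a + ½ * b) ≡ 2ℚ * a + b
    collect = solve-∀ ringℚ
    neg-square : ∀ a b → (- a - - b) * (- a - - b) ≡ (a - b) * (a - b)
    neg-square = solve-∀ ringℚ
    𝓔-neg : 𝓔 (λ x → - h x) (λ x → - h x) ≡ 𝓔 h h
    𝓔-neg = sum-cong-≗ λ x → sum-cong-≗ λ y → cong (adj x y *_) (neg-square (h x) (h y))

-- The broadcast time as an oscillation of inform times.

least-zero : ∀ {N} {P : Pred (Fin (suc N)) 0ℓ} (P? : Decidable P) → P zero → least P? ≡ 0
least-zero P? p rewrite dec-true (P? zero) p = refl

least-suc : ∀ {N} {P : Pred (Fin (suc N)) 0ℓ} (P? : Decidable P) → ¬ P zero → least P? ≡ suc (least (P? ∘ suc))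
least-suc P? ¬p rewrite dec-false (P? zero) ¬p = refl

-- The pathwise bounds rely on increasing informed sets, which arbitrary vectors of subsets lack;
-- all outcomes of the push process have this shape, so comparing expectations on runs suffices.
data Run {n} : ∀ {N} → Subset n → Vec (Subset n) (suc N) → Set where
  stop : ∀ {I} → Run I (I Vec.∷ Vec.[])
  step : ∀ {N I J} {ω : Vec (Subset n) (suc N)} → I ⊆ J → Run J ω → Run I (I Vec.∷ ω)

module Broadcast {n} (G : Graph n) (degree>0 : ∀ x → 0 ℕ.< degree G x) {D : ℚ}
                 (d≤D : ∀ x → ι (degree G x) ℚ.≤ D) (1≤D : 1ℚ ℚ.≤ D) where
  open RandomWalk G degree>0
  open HittingTimes G degree>0
  open Oscillation G degree>0
  open PushProcess G degree>0 d≤D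
  open Delays G degree>0 d≤D 1≤D
  open Hitting using (U)

  E-mono-runs : ∀ N I {f g : Vec (Subset n) (suc N) → ℚ} → (∀ {ω} → Run I ω → f ω ℚ.≤ g ω) →
                E (trajectory (pushStep G) N I) f ℚ.≤ E (trajectory (pushStep G) N I) g
  E-mono-runs zero    I {f} {g} f≤g =
    subst₂ ℚ._≤_ (sym (E-return (I Vec.∷ Vec.[]) f)) (sym (E-return (I Vec.∷ Vec.[]) g)) (f≤g stop)
  E-mono-runs (suc N) I {f} {g} f≤g = subst₂ ℚ._≤_ (sym (E-push N I f)) (sym (E-push N I g))
    (monotone (choices-isProbability I) λ ch →
      E-mono-runs N (after I ch) (f≤g ∘ step (p⊆p∪q (⋃ (List.map ⁅_⁆ ch)))))

  -- Counting the uninformed states gives τ v on a run, capped at the number of states, and makes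
  -- differences of inform times additive along the path.
  informTime : ∀ {N} → Vec (Subset n) N → Fin n → ℚ
  informTime Vec.[]      v = 0ℚ
  informTime (I Vec.∷ ω) v = (1ℚ - 𝟙 (v ∈? I)) + informTime ω v

  informTime-nonNeg : ∀ {N} (ω : Vec (Subset n) N) v → 0ℚ ℚ.≤ informTime ω v
  informTime-nonNeg Vec.[]      v = ℚ.≤-refl
  informTime-nonNeg (I Vec.∷ ω) v = +-nonNeg (1-𝟙≥0 (v ∈? I)) (informTime-nonNeg ω v)

  informTime-informed : ∀ {N I} {ω : Vec (Subset n) (suc N)} {v} → Run I ω → v ∈ I → informTime ω v ≡ 0ℚ
  informTime-informed {I = I} {v = v} stop v∈I rewrite dec-true (v ∈? I) v∈I = refl
  informTime-informed {I = I} {v = v} (step I⊆J r) v∈I rewrite dec-true (v ∈? I) v∈I =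
    trans (ℚ.+-identityˡ _) (informTime-informed r (I⊆J v∈I))

  informTime-suc : ∀ {N I} (ω : Vec (Subset n) N) {v} → v ∉ I → informTime (I Vec.∷ ω) v ≡ 1ℚ + informTime ω v
  informTime-suc {I = I} ω {v} v∉I rewrite dec-false (v ∈? I) v∉I = refl

  broadcastTime : ∀ {N} → Vec (Subset n) N → ℕ
  broadcastTime ω = least (allInformed? G ω)

  broadcast≤inform : ∀ {N I} {ω : Vec (Subset n) (suc N)} → Fin n → Run I ω →
                     ∃[ v ] ι (broadcastTime ω) ℚ.≤ informTime ω v
  broadcast≤inform {I = I} s stop = by-cases (Fin.all? (_∈? I))
    where
    ω = I Vec.∷ Vec.[]
    by-cases : Dec (∀ v → v ∈ I) → ∃[ v ] ι (broadcastTime ω) ℚ.≤ informTime ω v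
    by-cases (yes all) = s , subst (λ k → ι k ℚ.≤ informTime ω s) (sym (least-zero (allInformed? G ω) all)) (informTime-nonNeg ω s)
    by-cases (no ¬all) = v , subst₂ (λ k p → ι k ℚ.≤ p) (sym (least-suc (allInformed? G ω) ¬all))
                                    (sym (informTime-suc Vec.[] v∉I)) ℚ.≤-refl
      where
      v = proj₁ (Fin.¬∀⟶∃¬ n (_∈ I) (_∈? I) ¬all)
      v∉I = proj₂ (Fin.¬∀⟶∃¬ n (_∈ I) (_∈? I) ¬all)
  broadcast≤inform {I = I} s (step {ω = ω} I⊆J r) = by-cases (Fin.all? (_∈? I)) (v ∈? I)
    where
    v = proj₁ (broadcast≤inform s r)
    T≤v = proj₂ (broadcast≤inform s r)
    later : ¬ (∀ v → v ∈ I) → ∀ {w} → w ∉ I → ι (broadcastTime ω) ℚ.≤ informTime ω w →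
            ι (broadcastTime (I Vec.∷ ω)) ℚ.≤ informTime (I Vec.∷ ω) w
    later ¬all {w} w∉I T≤w = subst₂ (λ k p → ι k ℚ.≤ p) (sym (least-suc (allInformed? G (I Vec.∷ ω)) ¬all))
      (sym (informTime-suc ω w∉I))
      (subst (ℚ._≤ 1ℚ + informTime ω w) (sym (ι-suc (broadcastTime ω))) (ℚ.+-monoʳ-≤ 1ℚ T≤w))
    by-cases : Dec (∀ v → v ∈ I) → Dec (v ∈ I) → ∃[ w ] ι (broadcastTime (I Vec.∷ ω)) ℚ.≤ informTime (I Vec.∷ ω) w
    by-cases (yes all) _       = s , subst (λ k → ι k ℚ.≤ informTime (I Vec.∷ ω) s)
      (sym (least-zero (allInformed? G (I Vec.∷ ω)) all)) (informTime-nonNeg (I Vec.∷ ω) s)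
    by-cases (no ¬all) (no v∉I)  = v , later ¬all v∉I T≤v
    -- If `v` is already informed, its later inform time is 0, so the remaining broadcast time is 0
    -- as well and any uninformed `w` can take its place.
    by-cases (no ¬all) (yes v∈I) = w , later ¬all w∉I (ℚ.≤-trans T≤v
      (subst (ℚ._≤ informTime ω w) (sym (informTime-informed r (I⊆J v∈I))) (informTime-nonNeg ω w)))
      where
      w = proj₁ (Fin.¬∀⟶∃¬ n (_∈ I) (_∈? I) ¬all)
      w∉I = proj₂ (Fin.¬∀⟶∃¬ n (_∈ I) (_∈? I) ¬all)

  -- State by state this is `j - i = j * (1 - i) - i * (1 - j)` for the indicators of `x` and `y`.
  informTime-difference : ∀ {N} (ω : Vec (Subset n) N) x y →
                          informTime ω x - informTime ω y ≡ delay y x ω - delay x y ω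
  informTime-difference Vec.[]      x y = refl
  informTime-difference (I Vec.∷ ω) x y = begin
    (1ℚ - i + a) - (1ℚ - j + b)                    ≡⟨ left i j a b ⟩
    (j - i) + (a - b)                              ≡⟨ cong (j - i +_) (informTime-difference ω x y) ⟩
    (j - i) + (c - e)                              ≡⟨ right i j c e ⟩
    (j * (1ℚ - i) + c) - (i * (1ℚ - j) + e)        ∎
    where
    open ≡-Reasoning
    i = 𝟙 (x ∈? I)
    j = 𝟙 (y ∈? I)
    a = informTime ω x
    b = informTime ω y
    c = delay y x ω
    e = delay x y ω
    left : ∀ i j a b → (1ℚ - i + a) - (1ℚ - j + b) ≡ (j - i) + (a - b)
    left = solve-∀ ringℚ
    right : ∀ i j c e → (j - i) + (c - e) ≡ (j * (1ℚ - i) + c) - (i * (1ℚ - j) + e)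
    right = solve-∀ ringℚ

  delays² : ∀ {N} → Vec (Subset n) N → ℚ
  delays² ω = sum λ y → sum λ x → adj x y * (delay x y ω * delay x y ω)

  𝓔-informTime≤ : ∀ {N} (ω : Vec (Subset n) N) → 𝓔 (informTime ω) (informTime ω) ℚ.≤ 2ℚ * delays² ω
  𝓔-informTime≤ ω = begin
    𝓔 (informTime ω) (informTime ω)             ≤⟨ sum-mono (λ x → sum-mono (λ y → termwise x y)) ⟩
    sum (λ x → sum (λ y → a x y + a y x))       ≡⟨ sum-cong-≗ (λ x → ∑-distrib-+ (a x) (λ y → a y x)) ⟩
    sum (λ x → sum (a x) + sum (λ y → a y x))   ≡⟨ ∑-distrib-+ (λ x → sum (a x)) (λ x → sum (λ y → a y x)) ⟩
    sum (λ x → sum (a x)) + delays² ω           ≡⟨ cong (_+ delays² ω) (∑-comm a) ⟩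
    delays² ω + delays² ω                       ≡⟨ double (delays² ω) ⟩
    2ℚ * delays² ω                              ∎
    where
    open ℚ.≤-Reasoning
    a : Fin n → Fin n → ℚ
    a x y = adj x y * (delay x y ω * delay x y ω)
    double : ∀ s → s + s ≡ 2ℚ * s
    double = solve-∀ ringℚ
    termwise : ∀ x y → adj x y * ((informTime ω x - informTime ω y) * (informTime ω x - informTime ω y)) ℚ.≤ a x y + a y x
    termwise x y = subst₂ (λ z w → adj x y * (z * z) ℚ.≤ a x y + w * (delay y x ω * delay y x ω))
      (sym (informTime-difference ω x y)) (adj-sym x y)
      (≤-from-gap (*-nonNeg (0≤adj x y) (*-nonNeg {2ℚ} (0≤ι 2) (*-nonNeg (delay-nonNeg x y ω) (delay-nonNeg y x ω))))
                  (collect (adj x y) (delay x y ω) (delay y x ω)))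
      where
      collect : ∀ w c e → w * ((e - c) * (e - c)) + w * (2ℚ * (c * e)) ≡ w * (c * c) + w * (e * e)
      collect = solve-∀ ringℚ

  E-delays²≤ : ∀ N I → E (trajectory (pushStep G) N I) delays² ℚ.≤ ι n * (ι 6 * (D * D))
  E-delays²≤ N I = begin
    E tr delays²                                                            ≡⟨ E-sum tr (λ y ω → sum λ x → adj x y * (delay x y ω * delay x y ω)) ⟩
    sum (λ y → E tr (λ ω → sum λ x → adj x y * (delay x y ω * delay x y ω))) ≤⟨ sum-mono (λ y → E-delay²≤ y N I) ⟩
    sum {n} (λ _ → ι 6 * (D * D))                                           ≡⟨ sum-const n (ι 6 * (D * D)) ⟩
    ι n * (ι 6 * (D * D))                                                   ∎
    where
    open ℚ.≤-Reasoning
    tr = trajectory (pushStep G) N I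

  -- `oscillation` is applied to the inform times of every single run with fixed weights. The source
  -- has inform time 0, so the oscillation is the largest inform time, and only the energy needs
  -- averaging.
  E-broadcast≤ : ∀ {M l μ} → (∀ t x → U t (horizon t) x ℚ.≤ M) → 0ℚ ℚ.≤ l → 0ℚ ℚ.≤ μ → l * μ ≡ 1ℚ → ∀ N s →
    vol * 𝔼 (trajectory (pushStep G) N ⁅ s ⁆) broadcastTime ℚ.≤
    2ℚ * (l * (vol * M)) + μ * (2ℚ * (ι n * (ι 6 * (D * D))))
  E-broadcast≤ {M} {l} {μ} U≤M 0≤l 0≤μ lμ≡1 N s = begin
    vol * E tr (ι ∘ broadcastTime)                 ≡⟨ E-*ˡ tr vol (ι ∘ broadcastTime) ⟨
    E tr (λ ω → vol * ι (broadcastTime ω))         ≤⟨ E-mono-runs N ⁅ s ⁆ pathwise ⟩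
    E tr (λ ω → K + μ * (2ℚ * delays² ω))          ≡⟨ E-+ tr (λ _ → K) (λ ω → μ * (2ℚ * delays² ω)) ⟩
    E tr (λ _ → K) + E tr (λ ω → μ * (2ℚ * delays² ω))
      ≡⟨ cong₂ _+_ (E-const (trajectory-isProbability pushStep-isProbability N ⁅ s ⁆) K)
           (trans (E-*ˡ tr μ (λ ω → 2ℚ * delays² ω)) (cong (μ *_) (E-*ˡ tr 2ℚ delays²))) ⟩
    K + μ * (2ℚ * E tr delays²)                    ≤⟨ ℚ.+-monoʳ-≤ K (*-monoˡ-≤ 0≤μ (*-monoˡ-≤ {2ℚ} (0≤ι 2) (E-delays²≤ N ⁅ s ⁆))) ⟩
    K + μ * (2ℚ * (ι n * (ι 6 * (D * D))))         ∎
    where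
    open ℚ.≤-Reasoning
    tr = trajectory (pushStep G) N ⁅ s ⁆
    K = 2ℚ * (l * (vol * M))
    0≤vol : 0ℚ ℚ.≤ vol
    0≤vol = ℚ.<⇒≤ (vol>0 s)
    pathwise : ∀ {ω} → Run ⁅ s ⁆ ω → vol * ι (broadcastTime ω) ℚ.≤ K + μ * (2ℚ * delays² ω)
    pathwise {ω} r = begin
      vol * ι (broadcastTime ω)  ≤⟨ *-monoˡ-≤ 0≤vol (ℚ.≤-trans (proj₂ (broadcast≤inform s r)) (h-max (proj₁ (broadcast≤inform s r)))) ⟩
      vol * h v                  ≡⟨ cong (vol *_) (trans (sym (ℚ.+-identityʳ (h v))) (cong (λ z → h v - z) (sym hs≡0))) ⟩
      vol * (h v - h s)          ≤⟨ oscillation h U≤M (λ x → subst (ℚ._≤ h x) (sym hs≡0) (informTime-nonNeg ω x)) h-max 0≤l lμ≡1 ⟩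
      K + μ * 𝓔 h h              ≤⟨ ℚ.+-monoʳ-≤ K (*-monoˡ-≤ 0≤μ (𝓔-informTime≤ ω)) ⟩
      K + μ * (2ℚ * delays² ω)   ∎
      where
      h = informTime ω
      hs≡0 : h s ≡ 0ℚ
      hs≡0 = informTime-informed r (x∈⁅x⁆ s)
      v = proj₁ (argmax s h)
      h-max : ∀ x → h x ℚ.≤ h v
      h-max = proj₂ (argmax s h)

-- Degrees, and the comparison of order, volume and hitting times.

foldr-⊓≤ : ∀ b {k ks} → k List.∈ ks → List.foldr _⊓_ b ks ≤ k
foldr-⊓≤ b {ks = j ∷ ks} (here refl)  = ℕ.m⊓n≤m j (List.foldr _⊓_ b ks)
foldr-⊓≤ b {ks = j ∷ ks} (there k∈ks) = ℕ.≤-trans (ℕ.m⊓n≤n j (List.foldr _⊓_ b ks)) (foldr-⊓≤ b k∈ks)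

≤foldr-⊓ : ∀ {b c} (f : A → ℕ) → c ≤ b → (∀ a → c ≤ f a) → ∀ as → c ≤ List.foldr _⊓_ b (List.map f as)
≤foldr-⊓ f c≤b c≤f []       = c≤b
≤foldr-⊓ f c≤b c≤f (a ∷ as) = ℕ.⊓-glb (c≤f a) (≤foldr-⊓ f c≤b c≤f as)

≤foldr-⊔ : ∀ b {k ks} → k List.∈ ks → k ≤ List.foldr _⊔_ b ks
≤foldr-⊔ b {ks = j ∷ ks} (here refl)  = ℕ.m≤m⊔n j (List.foldr _⊔_ b ks)
≤foldr-⊔ b {ks = j ∷ ks} (there k∈ks) = ℕ.≤-trans (≤foldr-⊔ b k∈ks) (ℕ.m≤n⊔m j (List.foldr _⊔_ b ks))

module Degrees {n} (2≤n : 2 ≤ n) (G : Graph n) where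
  open Graph G

  another : ∀ x → ∃[ y ] x ≢ y
  another = distinct 2≤n
    where
    distinct : ∀ {n} → 2 ≤ n → (x : Fin n) → ∃[ y ] x ≢ y
    distinct (ℕ.s≤s (ℕ.s≤s _)) zero    = suc zero , λ ()
    distinct (ℕ.s≤s (ℕ.s≤s _)) (suc _) = zero , λ ()

  vertex : Fin n
  vertex = Fin.fromℕ< (ℕ.≤-trans (ℕ.s≤s ℕ.z≤n) 2≤n)

  degree>0 : ∀ x → 0 ℕ.< degree G x
  degree>0 x = start (connected x (proj₁ (another x))) (proj₂ (another x))
    where
    start : ∀ {y} → Star _~_ x y → x ≢ y → 0 ℕ.< degree G x
    start ε                 x≢x = contradiction refl x≢x
    start (_◅_ {j = z} x~z _) _ = ∈-length (∈-filter⁺ (x ~?_) (∈-allFin z) x~z)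

  minDegree≤ : ∀ x → minDegree G ≤ degree G x
  minDegree≤ x = foldr-⊓≤ n (∈-map⁺ (degree G) (∈-allFin x))

  ≤maxDegree : ∀ x → degree G x ≤ maxDegree G
  ≤maxDegree x = ≤foldr-⊔ 0 (∈-map⁺ (degree G) (∈-allFin x))

  minDegree>0 : 0 ℕ.< minDegree G
  minDegree>0 = ≤foldr-⊓ (degree G) (ℕ.≤-trans (ℕ.s≤s ℕ.z≤n) 2≤n) degree>0 (allFin n)

module Comparison {n} (2≤n : 2 ≤ n) (G : Graph n) {q} (Δ≤qδ : maxDegree G ≤ q ℕ.* minDegree G) where
  open Degrees 2≤n G
  open RandomWalk G degree>0
  open HittingTimes G degree>0
  open Oscillation G degree>0
  open Hitting using (U; U≤E-cover; U-off; P-nonNeg; U-nonNeg)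

  δ Δ : ℚ
  δ = ι (minDegree G)
  Δ = ι (maxDegree G)

  δ>0 : 0ℚ ℚ.< δ
  δ>0 = ℚ.<-≤-trans (0<ι-suc 0) (ι-mono-≤ minDegree>0)

  Δ≤ : Δ ℚ.≤ ι q * δ
  Δ≤ = subst (Δ ℚ.≤_) (ι-* q (minDegree G)) (ι-mono-≤ Δ≤qδ)

  nδ≤vol : ι n * δ ℚ.≤ vol
  nδ≤vol = subst (ℚ._≤ vol) (sum-const n δ) (sum-mono λ x → ι-mono-≤ (minDegree≤ x))

  1≤Δ : 1ℚ ℚ.≤ Δ
  1≤Δ = ℚ.≤-trans (d≥1 vertex) (ι-mono-≤ (≤maxDegree vertex))

  open Broadcast G degree>0 {Δ} (λ x → ι-mono-≤ (≤maxDegree x)) 1≤Δ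

  module _ {M : ℚ} (U≤M : ∀ t x → U t (horizon t) x ℚ.≤ M) where

    1≤M : 1ℚ ℚ.≤ M
    1≤M = ℚ.≤-trans (subst (1ℚ ℚ.≤_) (sym (U-off y k vertex (proj₂ (another vertex))))
                      (≤-from-gap (P-nonNeg y (U-nonNeg y k) vertex) refl))
                    (U≤M y vertex)
      where
      y = proj₁ (another vertex)
      k = proj₁ (survival≤½ y)

    -- The volume is at least n δ, while `vol≤` bounds it by a degree times 1 + 2 M; the 3 absorbs
    -- the 1, as `1≤M`.
    n≤3qM : ι n ℚ.≤ ι 3 * (ι q * M)
    n≤3qM = *-cancelˡ-≤ δ>0 (begin
      δ * ι n                ≡⟨ ℚ.*-comm δ (ι n) ⟩
      ι n * δ                ≤⟨ nδ≤vol ⟩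
      vol                                ≤⟨ vol≤ vertex {horizon vertex} (proj₂ (survival≤½ vertex)) (U≤M vertex) ⟩
      d vertex + 2ℚ * (d vertex * M)         ≡⟨ factor (d vertex) M ⟩
      d vertex * (1ℚ + 2ℚ * M)             ≤⟨ *-mono-≤ (0≤d vertex) 0≤3M (ℚ.≤-trans (ι-mono-≤ (≤maxDegree vertex)) Δ≤)
                                              (≤-from-gap (p≤q⇒0≤q-p 1≤M) (collect M)) ⟩
      ι q * δ * (ι 3 * M)                ≡⟨ regroup (ι q) δ M ⟩
      δ * (ι 3 * (ι q * M))              ∎)
      where
      open ℚ.≤-Reasoning
      0≤3M : 0ℚ ℚ.≤ ι 3 * M
      0≤3M = *-nonNeg (0≤ι 3) (ℚ.≤-trans (0≤ι 1) 1≤M)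
      factor : ∀ d m → d + 2ℚ * (d * m) ≡ d * (1ℚ + 2ℚ * m)
      factor = solve-∀ ringℚ
      collect : ∀ m → 1ℚ + 2ℚ * m + (m - 1ℚ) ≡ ι 3 * m
      collect = solve-∀ ringℚ
      regroup : ∀ q d m → q * d * (ι 3 * m) ≡ d * (ι 3 * (q * m))
      regroup = solve-∀ ringℚ

    -- One factor n δ hidden in n Δ² ≤ q² δ (n δ) is cancelled by the volume, so the energy
    -- contributes only O(δ); 12 is 2 times the 6 of `Φ`.
    E-broadcast≤′ : ∀ {l μ} → 0ℚ ℚ.≤ l → 0ℚ ℚ.≤ μ → l * μ ≡ 1ℚ → ∀ N s →
      𝔼 (trajectory (pushStep G) N ⁅ s ⁆) broadcastTime ℚ.≤ 2ℚ * (l * M) + ι 12 * (ι q * ι q * δ) * μ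
    E-broadcast≤′ {l} {μ} 0≤l 0≤μ lμ≡1 N s = *-cancelˡ-≤ (vol>0 vertex) (begin
      vol * 𝔼 (trajectory (pushStep G) N ⁅ s ⁆) broadcastTime            ≤⟨ E-broadcast≤ U≤M 0≤l 0≤μ lμ≡1 N s ⟩
      2ℚ * (l * (vol * M)) + μ * (2ℚ * (ι n * (ι 6 * (Δ * Δ))))
        ≤⟨ ℚ.+-monoʳ-≤ (2ℚ * (l * (vol * M))) (*-monoˡ-≤ 0≤μ (*-monoˡ-≤ {2ℚ} (0≤ι 2) nΔ²≤)) ⟩
      2ℚ * (l * (vol * M)) + μ * (2ℚ * (ι 6 * (ι q * ι q * δ * vol)))    ≡⟨ regroup l vol M μ (ι q * ι q * δ) ⟩
      vol * (2ℚ * (l * M) + ι 12 * (ι q * ι q * δ) * μ)                  ∎)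
      where
      open ℚ.≤-Reasoning
      0≤qδ : 0ℚ ℚ.≤ ι q * δ
      0≤qδ = *-nonNeg (0≤ι q) (ℚ.<⇒≤ δ>0)
      nΔ²≤ : ι n * (ι 6 * (Δ * Δ)) ℚ.≤ ι 6 * (ι q * ι q * δ * vol)
      nΔ²≤ = begin
        ι n * (ι 6 * (Δ * Δ))
          ≤⟨ *-monoˡ-≤ (0≤ι n) (*-monoˡ-≤ (0≤ι 6) (*-mono-≤ (0≤ι (maxDegree G)) 0≤qδ Δ≤ Δ≤)) ⟩
        ι n * (ι 6 * (ι q * δ * (ι q * δ)))      ≡⟨ pull (ι n) (ι q) δ ⟩
        ι 6 * (ι q * ι q * δ * (ι n * δ))
          ≤⟨ *-monoˡ-≤ (0≤ι 6) (*-monoˡ-≤ (*-nonNeg (*-nonNeg (0≤ι q) (0≤ι q)) (ℚ.<⇒≤ δ>0)) nδ≤vol) ⟩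
        ι 6 * (ι q * ι q * δ * vol)                          ∎
        where
        pull : ∀ n q d → n * (ι 6 * (q * d * (q * d))) ≡ ι 6 * (q * q * d * (n * d))
        pull = solve-∀ ringℚ
      regroup : ∀ l v m μ c → 2ℚ * (l * (v * m)) + μ * (2ℚ * (ι 6 * (c * v))) ≡ v * (2ℚ * (l * m) + ι 12 * c * μ)
      regroup = solve-∀ ringℚ

  -- The maximum is attained at some target `t` and start `s`, so it is dominated by one truncated
  -- expectation of the cover time from `s`.
  largestHittingTime : ∃[ M ] (∀ t x → U t (horizon t) x ℚ.≤ M) ×
    ∃[ s ] ∃[ N ] M ℚ.≤ 𝔼 (trajectory (walkStep G) N s) (λ ω → least (covered? G ω))
  largestHittingTime = U t (horizon t) s
    , (λ t′ x → ℚ.≤-trans (proj₂ (farthest t′) x) (proj₂ (argmax vertex λ t → U t (horizon t) (proj₁ (farthest t))) t′))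
    , s , proj₁ (survival≤½ t) , U≤E-cover t (proj₁ (survival≤½ t)) s
    where
    farthest : ∀ t → ∃[ x ] (∀ y → U t (horizon t) y ℚ.≤ U t (horizon t) x)
    farthest t = argmax vertex (U t (horizon t))
    t = proj₁ (argmax vertex λ t → U t (horizon t) (proj₁ (farthest t)))
    s = proj₁ (farthest t)

-- Extended non-negative reals

fromℚ-below : ∀ {p q} → 0ℚ ℚ.≤ p → Below (fromℚ q) p → p ℚ.< q
fromℚ-below 0≤p (inj₁ p<0)             = contradiction (ℚ.≤-<-trans 0≤p p<0) (ℚ.<-irrefl refl)
fromℚ-below 0≤p (inj₂ (_ , refl , p<q)) = p<q

below-fromℚ : ∀ {p q} → p ℚ.< q → Below (fromℚ q) p
below-fromℚ p<q = inj₂ (_ , refl , p<q)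

fromℚ-mono : ∀ {p q} → p ℚ.≤ q → fromℚ p ≤∞ fromℚ q
fromℚ-mono p≤q r (inj₁ r<0)             = inj₁ r<0
fromℚ-mono p≤q r (inj₂ (_ , refl , r<p)) = below-fromℚ (ℚ.<-≤-trans r<p p≤q)

⨆-least : {I : Set} {x : I → [0,∞]} {y : [0,∞]} → (∀ i → x i ≤∞ y) → ⨆ x ≤∞ y
⨆-least {y = y} x≤y q (inj₁ q<0)                = [0,∞].neg-below y q<0
⨆-least {y = y} x≤y q (inj₂ (r , (i , r<x) , q<r)) = [0,∞].down-close y (ℚ.<⇒≤ q<r) (x≤y i r r<x)

⨆-upper : {I : Set} {x : I → [0,∞]} (i : I) → x i ≤∞ ⨆ x
⨆-upper {x = x} i q q<x = let r , q<r , r<x = [0,∞].rounded (x i) q<x in inj₂ (r , (i , r<x) , q<r)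

·-below : ∀ {x y p} → 0ℚ ℚ.≤ p → Below (x · y) p → ∃[ a ] ∃[ b ]
          0ℚ ℚ.≤ a × Below x a × 0ℚ ℚ.≤ b × Below y b × p ℚ.< a * b
·-below 0≤p (inj₁ p<0) = contradiction (ℚ.≤-<-trans 0≤p p<0) (ℚ.<-irrefl refl)
·-below 0≤p (inj₂ (_ , (a , b , 0≤a , a<x , 0≤b , b<y , refl) , p<ab)) = a , b , 0≤a , a<x , 0≤b , b<y , p<ab

expTerm-nonNeg : ∀ j → 0ℚ ℚ.≤ expTerm ½ j
expTerm-nonNeg zero    = 0≤ι 1
expTerm-nonNeg (suc j) = *-nonNeg (*-nonNeg (expTerm-nonNeg j) (ℚ.nonNegative⁻¹ ½))
                                  (ℚ.nonNegative⁻¹ (pos 1 ℚ./ suc j) {{ℚ.normalize-nonNeg 1 (suc j)}})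

2*expTerm-suc≤ : ∀ j → 2ℚ * expTerm ½ (suc j) ℚ.≤ expTerm ½ j
2*expTerm-suc≤ j = begin
  2ℚ * (e * ½ * i)  ≡⟨ regroup e i ⟩
  e * i             ≤⟨ *-monoˡ-≤ (expTerm-nonNeg j) i≤1 ⟩
  e * 1ℚ            ≡⟨ ℚ.*-identityʳ e ⟩
  e                 ∎
  where
  open ℚ.≤-Reasoning
  e = expTerm ½ j
  i = pos 1 ℚ./ suc j
  regroup : ∀ e i → 2ℚ * (e * ½ * i) ≡ e * i
  regroup = solve-∀ ringℚ
  i≤1 : i ℚ.≤ 1ℚ
  i≤1 = subst₂ ℚ._≤_ (ℚ.*-identityˡ i) (1/suc-inverse j)
    (*-monoʳ-≤ (ℚ.nonNegative⁻¹ i {{ℚ.normalize-nonNeg 1 (suc j)}}) (ι-mono-≤ {1} {suc j} (ℕ.s≤s ℕ.z≤n)))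

-- The terms at least halve, so twice the next term dominates the whole tail; keeping it in the
-- invariant makes the induction close and gives exp ½ ≤ 2.
expSum+2*expTerm≤2 : ∀ k → expSum ½ k + 2ℚ * expTerm ½ k ℚ.≤ 2ℚ
expSum+2*expTerm≤2 zero    = ℚ.≤-refl
expSum+2*expTerm≤2 (suc k) = begin
  s + e + 2ℚ * expTerm ½ (suc k)  ≤⟨ ℚ.+-monoʳ-≤ (s + e) (2*expTerm-suc≤ k) ⟩
  s + e + e                       ≡⟨ regroup s e ⟩
  s + 2ℚ * e                      ≤⟨ expSum+2*expTerm≤2 k ⟩
  2ℚ                              ∎
  where
  open ℚ.≤-Reasoning
  s = expSum ½ k
  e = expTerm ½ k
  regroup : ∀ s e → s + e + e ≡ s + 2ℚ * e
  regroup = solve-∀ ringℚ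

exp½≤ : ∀ {n} → 2 ≤ n → exp ½ ≤∞ fromℕ n
exp½≤ {n} 2≤n = ⨆-least {x = fromℚ ∘ expSum ½} {y = fromℕ n} λ k → fromℚ-mono (ℚ.≤-trans
  (≤-from-gap (*-nonNeg {2ℚ} (0≤ι 2) (expTerm-nonNeg k)) refl)
  (ℚ.≤-trans (expSum+2*expTerm≤2 k) (ι-mono-≤ 2≤n)))

½≤log : ∀ {n r} → 2 ≤ n → 0ℚ ℚ.< r → log (fromℕ n) ≤∞ fromℚ r → ½ ℚ.≤ r
½≤log {n} {r} 2≤n 0<r log≤r = ℚ.≮⇒≥ λ r<½ →
  let p , r<p , p<½ = ℚ.<-dense r<½
      p<log = inj₂ (½ , (ℚ.nonNegative⁻¹ ½ , exp½≤ 2≤n) , p<½)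
  in ℚ.<-asym r<p (fromℚ-below (ℚ.<⇒≤ (ℚ.<-trans 0<r r<p)) (log≤r p p<log))

1÷log-below : ∀ {n b} → 2 ≤ n → 0ℚ ℚ.≤ b → Below (fromℕ 1 ÷ log (fromℕ n)) b → b ℚ.≤ 2ℚ
1÷log-below 2≤n 0≤b (inj₁ b<0) = contradiction (ℚ.≤-<-trans 0≤b b<0) (ℚ.<-irrefl refl)
1÷log-below {b = b} 2≤n 0≤b (inj₂ (t , (a , r , a<1 , 0<r , log≤r , tr≡a) , b<t)) =
  ℚ.≤-trans (ℚ.<⇒≤ b<t) (≤-from-gap (*-nonNeg {2ℚ} (0≤ι 2) (p≤q⇒0≤q-p t½≤1)) (collect t))
  where
  0≤t : 0ℚ ℚ.≤ t
  0≤t = ℚ.<⇒≤ (ℚ.≤-<-trans 0≤b b<t)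
  0≤a : 0ℚ ℚ.≤ a
  0≤a = subst (0ℚ ℚ.≤_) tr≡a (*-nonNeg 0≤t (ℚ.<⇒≤ 0<r))
  t½≤1 : t * ½ ℚ.≤ 1ℚ
  t½≤1 = ℚ.≤-trans (*-monoˡ-≤ 0≤t (½≤log 2≤n 0<r log≤r)) (subst (ℚ._≤ 1ℚ) (sym tr≡a) (ℚ.<⇒≤ (fromℚ-below 0≤a a<1)))
  collect : ∀ t → t + 2ℚ * (1ℚ - t * ½) ≡ 2ℚ
  collect = solve-∀ ringℚ

-- If r² < k/4 then 2r witnesses that r lies strictly below √ k.
√≤⇒≤4r² : ∀ {k r} → 0ℚ ℚ.< r → √ fromℕ k ≤∞ fromℚ r → ι k ℚ.≤ (2ℚ * r) * (2ℚ * r)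
√≤⇒≤4r² {k} {r} 0<r √k≤r = ℚ.≮⇒≥ λ 4r²<k →
  ℚ.<-irrefl refl (fromℚ-below (ℚ.<⇒≤ 0<r)
    (√k≤r r (inj₂ (2ℚ * r , (*-nonNeg {2ℚ} (0≤ι 2) (ℚ.<⇒≤ 0<r) , below-fromℚ 4r²<k) , r<2r))))
  where
  double : ∀ r → r + r ≡ 2ℚ * r
  double = solve-∀ ringℚ
  r<2r : r ℚ.< 2ℚ * r
  r<2r = subst₂ ℚ._<_ (ℚ.+-identityʳ r) (double r) (ℚ.+-monoʳ-< r 0<r)

-- Squaring replaces the quotient of roots by a rational `x` and a polynomial inequality; the 4 is
-- the slack of `√≤⇒≤4r²`.
√÷√-below : ∀ {j k b} → 0ℚ ℚ.≤ b → Below (√ fromℕ j ÷ √ fromℕ k) b →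
            ∃[ x ] b ℚ.< x × x * x * ι k ℚ.≤ ι 4 * ι j
√÷√-below 0≤b (inj₁ b<0) = contradiction (ℚ.≤-<-trans 0≤b b<0) (ℚ.<-irrefl refl)
√÷√-below {j} {k} {b} 0≤b (inj₂ (x , (a , r , a<√j , 0<r , √k≤r , xr≡a) , b<x)) = x , b<x , (begin
  x * x * ι k                        ≤⟨ *-monoˡ-≤ (0≤p² x) (√≤⇒≤4r² {k} 0<r √k≤r) ⟩
  x * x * ((2ℚ * r) * (2ℚ * r))      ≡⟨ regroup x r ⟩
  ι 4 * ((x * r) * (x * r))          ≡⟨ cong (λ z → ι 4 * (z * z)) xr≡a ⟩
  ι 4 * (a * a)                      ≤⟨ *-monoˡ-≤ (0≤ι 4) (a²≤j a<√j) ⟩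
  ι 4 * ι j                          ∎)
  where
  open ℚ.≤-Reasoning
  regroup : ∀ x r → x * x * ((2ℚ * r) * (2ℚ * r)) ≡ ι 4 * ((x * r) * (x * r))
  regroup = solve-∀ ringℚ
  0≤a : 0ℚ ℚ.≤ a
  0≤a = subst (0ℚ ℚ.≤_) xr≡a (*-nonNeg (ℚ.<⇒≤ (ℚ.≤-<-trans 0≤b b<x)) (ℚ.<⇒≤ 0<r))
  a²≤j : Below (√ fromℕ j) a → a * a ℚ.≤ ι j
  a²≤j (inj₁ a<0) = contradiction (ℚ.≤-<-trans 0≤a a<0) (ℚ.<-irrefl refl)
  a²≤j (inj₂ (e , (0≤e , e²<j) , a<e)) =
    ℚ.≤-trans (*-mono-≤ 0≤a 0≤e (ℚ.<⇒≤ a<e) (ℚ.<⇒≤ a<e)) (ℚ.<⇒≤ (fromℚ-below (*-nonNeg 0≤e 0≤e) e²<j))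

-- A product of cuts is only accessible through rationals strictly below it, so the bound is
-- obtained by refuting `ι q * ι k < ι j`.
degree-ratio : ∀ {c q j k} → c ≤∞ fromℕ q → fromℕ j ≤∞ c · fromℕ k → j ≤ q ℕ.* k
degree-ratio {c} {q} {j} {k} c≤q j≤ck = ι-cancel-≤ (subst (ι j ℚ.≤_) (sym (ι-* q k)) (ℚ.≮⇒≥ λ qk<j →
  let a , b , 0≤a , a<c , 0≤b , b<k , qk<ab = ·-below {c} {fromℕ k} 0≤qk (j≤ck (ι q * ι k) (below-fromℚ qk<j))
  in ℚ.<-irrefl refl (ℚ.<-≤-trans qk<ab
       (*-mono-≤ 0≤a (0≤ι k) (ℚ.<⇒≤ (fromℚ-below 0≤a (c≤q a a<c))) (ℚ.<⇒≤ (fromℚ-below 0≤b b<k))))))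
  where
  0≤qk : 0ℚ ℚ.≤ ι q * ι k
  0≤qk = *-nonNeg (0≤ι q) (0≤ι k)

-- Constants and conclusion.

-- 144 is 12 · 4 · 3, from `E-broadcast≤′`, `√÷√-below` and `n≤3qM`. The outer 4 is a factor 2 for
-- using half of M and a factor 2 for 1 / log n ≤ 2.
constant : ℕ → ℚ
constant q = ι 4 * (2ℚ + ι 144 * (ι q * ι q * ι q))

constant>0 : ∀ q → 0ℚ ℚ.< constant q
constant>0 q = *-pos (0<ι-suc 3)
  (ℚ.+-mono-<-≤ (0<ι-suc 1) (*-nonNeg (0≤ι 144) (*-nonNeg (*-nonNeg (0≤ι q) (0≤ι q)) (0≤ι q))))

-- Taking l = 1 / x and μ = x in the broadcast bound gives the upper bound r with
-- x r = 2 M + 12 q² δ x² = O(M), since δ x² ≤ 4 n = O(M).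
𝓡-lower : ∀ {n} → 2 ≤ n → (G : Graph n) → ∀ {q} → maxDegree G ≤ q ℕ.* minDegree G →
          ∀ {C x p} → 0ℚ ℚ.≤ C → C * constant q ≡ 1ℚ →
          0ℚ ℚ.< x → x * x * ι (minDegree G) ℚ.≤ ι 4 * ι n → p ℚ.< C * x * 2ℚ → Below (𝓡 G) p
𝓡-lower {n} 2≤n G {q} Δ≤qδ {C} {x} {p} 0≤C C-eq 0<x x²δ≤4n p< = bound largestHittingTime
  where
  open Comparison 2≤n G {q} Δ≤qδ
  open ℚ.≤-Reasoning
  bound : _ → Below (𝓡 G) p
  bound (M , U≤M , s , N , M≤cover) = inj₂ (t , (½ * M , r , ½M<COV , 0<r , RBA≤r , tr≡½M) , p<t)
    where
    0<M : 0ℚ ℚ.< M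
    0<M = ℚ.<-≤-trans (0<ι-suc 0) (1≤M U≤M)
    l = proj₁ (inverse 0<x)
    0<l = proj₁ (proj₂ (inverse 0<x))
    lx≡1 : l * x ≡ 1ℚ
    lx≡1 = proj₂ (proj₂ (inverse 0<x))
    κ = ι q * ι q * δ
    0≤κ : 0ℚ ℚ.≤ κ
    0≤κ = *-nonNeg (*-nonNeg (0≤ι q) (0≤ι q)) (ℚ.<⇒≤ δ>0)
    r = 2ℚ * (l * M) + ι 12 * κ * x
    0<r : 0ℚ ℚ.< r
    0<r = ℚ.+-mono-<-≤ (*-pos {2ℚ} (0<ι-suc 1) (*-pos 0<l 0<M)) (*-nonNeg (*-nonNeg (0≤ι 12) 0≤κ) (ℚ.<⇒≤ 0<x))
    -- Membership in the cut of `COV G` is strict, hence half of `M` as the numerator of the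
    -- witness.
    t = ½ * M * proj₁ (inverse 0<r)
    tr≡½M : t * r ≡ ½ * M
    tr≡½M = trans (ℚ.*-assoc (½ * M) (proj₁ (inverse 0<r)) r)
      (trans (cong (½ * M *_) (proj₂ (proj₂ (inverse 0<r)))) (ℚ.*-identityʳ (½ * M)))
    RBA≤r : 𝔼[RBA] G ≤∞ fromℚ r
    RBA≤r = ⨆-least {x = RBAfrom G} {y = fromℚ r} λ s →
      ⨆-least {x = λ N → fromℚ (𝔼 (trajectory (pushStep G) N ⁅ s ⁆) (λ ω → least (allInformed? G ω)))} {y = fromℚ r} λ N →
      fromℚ-mono (E-broadcast≤′ U≤M (ℚ.<⇒≤ 0<l) (ℚ.<⇒≤ 0<x) lx≡1 N s)
    ½M<M : ½ * M ℚ.< M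
    ½M<M = subst₂ ℚ._<_ (ℚ.+-identityʳ (½ * M)) (halves M) (ℚ.+-monoʳ-< (½ * M) (*-pos {½} (ℚ.positive⁻¹ ½) 0<M))
      where
      halves : ∀ m → ½ * m + ½ * m ≡ m
      halves = solve-∀ ringℚ
    ½M<COV : Below (COV G) (½ * M)
    ½M<COV = ⨆-upper {x = COVfrom G} s (½ * M)
      (⨆-upper {x = λ N → fromℚ (𝔼 (trajectory (walkStep G) N s) (λ ω → least (covered? G ω)))} N (½ * M) (below-fromℚ (ℚ.<-≤-trans ½M<M M≤cover)))
    K = 2ℚ + ι 144 * (ι q * ι q * ι q)
    xr≤KM : x * r ℚ.≤ K * M
    xr≤KM = begin
      x * r                                                    ≡⟨ expand x l M (ι q * ι q) δ ⟩
      2ℚ * ((l * x) * M) + ι 12 * (ι q * ι q) * (x * x * δ)    ≡⟨ cong (λ z → 2ℚ * (z * M) + ι 12 * (ι q * ι q) * (x * x * δ)) lx≡1 ⟩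
      2ℚ * (1ℚ * M) + ι 12 * (ι q * ι q) * (x * x * δ)
        ≤⟨ ℚ.+-monoʳ-≤ (2ℚ * (1ℚ * M)) (*-monoˡ-≤ (*-nonNeg (0≤ι 12) (*-nonNeg (0≤ι q) (0≤ι q)))
             (ℚ.≤-trans x²δ≤4n (*-monoˡ-≤ (0≤ι 4) (n≤3qM U≤M)))) ⟩
      2ℚ * (1ℚ * M) + ι 12 * (ι q * ι q) * (ι 4 * (ι 3 * (ι q * M)))  ≡⟨ collect (ι q) M ⟩
      K * M ∎
      where
      expand : ∀ x l m c d → x * (2ℚ * (l * m) + ι 12 * (c * d) * x) ≡ 2ℚ * ((l * x) * m) + ι 12 * c * (x * x * d)
      expand = solve-∀ ringℚ
      collect : ∀ q m → 2ℚ * (1ℚ * m) + ι 12 * (q * q) * (ι 4 * (ι 3 * (q * m))) ≡ (2ℚ + ι 144 * (q * q * q)) * m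
      collect = solve-∀ ringℚ
    p<t : p ℚ.< t
    p<t = ℚ.<-≤-trans p< (*-cancelˡ-≤ 0<r (begin
      r * (C * x * 2ℚ)         ≡⟨ regroup r C x ⟩
      C * 2ℚ * (x * r)         ≤⟨ *-monoˡ-≤ (*-nonNeg 0≤C (0≤ι 2)) xr≤KM ⟩
      C * 2ℚ * (K * M)         ≡⟨ quarter C K M ⟩
      C * (ι 4 * K) * (½ * M)  ≡⟨ cong (_* (½ * M)) C-eq ⟩
      1ℚ * (½ * M)             ≡⟨ ℚ.*-identityˡ (½ * M) ⟩
      ½ * M                    ≡⟨ tr≡½M ⟨
      t * r                    ≡⟨ ℚ.*-comm t r ⟩
      r * t                    ∎))
      where
      regroup : ∀ r c x → r * (c * x * 2ℚ) ≡ c * 2ℚ * (x * r)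
      regroup = solve-∀ ringℚ
      quarter : ∀ c k m → c * 2ℚ * (k * m) ≡ c * (ι 4 * k) * (½ * m)
      quarter = solve-∀ ringℚ

theorem4p5 : (c : [0,∞]) → Finite c → fromℕ 1 ≤∞ c →
    ∃[ C ] Finite C × Positive C ×
    ((n : ℕ) → 2 ≤ n → (G : Graph n) →
    fromℕ (maxDegree G) ≤∞ c · fromℕ (minDegree G) →
    C · (√ fromℕ n ÷ √ fromℕ (minDegree G)) · (fromℕ 1 ÷ log (fromℕ n)) ≤∞ 𝓡 G)
theorem4p5 c (r , c≤r) _ = fromℚ C , (C , λ _ → id) , below-fromℚ 0<C , bound
  where
  -- A natural bound for `c`, found above its rational bound `r`; `C` is determined by it.
  q = proj₁ (archimedean r)
  C = proj₁ (inverse (constant>0 q))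
  0<C = proj₁ (proj₂ (inverse (constant>0 q)))
  C-eq = proj₂ (proj₂ (inverse (constant>0 q)))
  c≤q : c ≤∞ fromℕ q
  c≤q p p<c = fromℚ-mono (proj₂ (archimedean r)) p (c≤r p p<c)
  bound : (n : ℕ) → 2 ≤ n → (G : Graph n) → fromℕ (maxDegree G) ≤∞ c · fromℕ (minDegree G) →
          fromℚ C · (√ fromℕ n ÷ √ fromℕ (minDegree G)) · (fromℕ 1 ÷ log (fromℕ n)) ≤∞ 𝓡 G
  bound n 2≤n G Δ≤cδ p (inj₁ p<0) = inj₁ p<0
  bound n 2≤n G Δ≤cδ p (inj₂ (_ , (a , b , 0≤a , a<C√ , 0≤b , b<1/log , refl) , p<ab)) =
    let a₁ , b₁ , 0≤a₁ , a₁<C , 0≤b₁ , b₁<√ , a<a₁b₁ = ·-below {fromℚ C} {√ fromℕ n ÷ √ fromℕ (minDegree G)} 0≤a a<C√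
        -- The weight `l = 1 / x` is chosen anew for each rational below the left-hand side, so √(n
        -- / δ) itself never has to be represented.
        x , b₁<x , x²δ≤4n = √÷√-below {n} {minDegree G} 0≤b₁ b₁<√
        0<x = ℚ.≤-<-trans 0≤b₁ b₁<x
        a₁b₁≤Cx = *-mono-≤ 0≤a₁ (ℚ.<⇒≤ 0<x) (ℚ.<⇒≤ (fromℚ-below 0≤a₁ a₁<C)) (ℚ.<⇒≤ b₁<x)
        ab≤2Cx = *-mono-≤ 0≤a (0≤ι 2) (ℚ.≤-trans (ℚ.<⇒≤ a<a₁b₁) a₁b₁≤Cx) (1÷log-below {n} 2≤n 0≤b b<1/log)
    in 𝓡-lower 2≤n G {q} (degree-ratio {c} {q} c≤q Δ≤cδ) (ℚ.<⇒≤ 0<C) C-eq 0<x x²δ≤4n (ℚ.<-≤-trans p<ab ab≤2Cx)
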